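{- Let $p$ be an odd prime, $x\in\mathbb Z_p$ and $x\not\equiv-1\pmod p$. Then $$P_{\frac{p-1}2}(x)\equiv\Big(\frac{2(x+1)}p\Big)P_{\frac{p-1}2}\Big(\frac{3-x}{1+x}\Big)\pmod p.$$
   Context: $\mathbb Z_p$ denotes the set of rational numbers whose denominator (in lowest terms) is prime to $p$; congruences are in this ring. $P_n(x)$ is the $n$-th Legendre polynomial, defined by $\frac1{\sqrt{1-2xt+t^2}}=\sum_{n\ge0}P_n(x)t^n$, equivalently $P_n(x)=\frac1{2^n}\sum_{k=0}^{[n/2]}\frac{(-1)^k(2n-2k)!}{k!(n-k)!(n-2k)!}x^{n-2k}$. For $a\in\mathbb Z_p$, $\big(\frac ap\big)$ is the Legendre symbol of the residue of $a$ modulo $p$. -}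

module Defs where

import Algebra.Definitions.RawSemiring
open import Data.Bool.Base using (if_then_else_)
open import Data.Fin.Base using (Fin; toℕ)
open import Data.Fin.Properties using (any?)
open import Data.Integer.Base as ℤ using (ℤ; +_)
open import Data.Integer.Divisibility.Signed using () renaming (_∣?_ to _∣ℤ?_)
open import Data.Nat.Base as ℕ using (ℕ; suc; _!; ⌊_/2⌋; _∸_)
import Data.Nat.Properties as ℕₚ
open import Data.Nat.Coprimality using (Coprime; coprime?; 1-coprimeTo)
open import Data.Product.Base using (∃; _×_; _,_)
open import Data.Rational.Base
open import Data.Rational.Properties
open import Relation.Nullary.Decidable using (Dec; yes; no; does; map′; _×-dec_)
open import Relation.Nullary.Negation using (¬_)
open import Relation.Binary.PropositionalEquality
  using (_≡_; refl; sym; trans; cong)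

open Algebra.Definitions.RawSemiring +-*-rawSemiring public using (sum; _^_)

fromℤ : ℤ → ℚ
fromℤ i = i / 1

fromℕ : ℕ → ℚ
fromℕ n = fromℤ (+ n)

-- Membership in ℤₚ, viewed as a subset of ℚ.
record Integral (p : ℕ) (a : ℚ) : Set where
  constructor integral
  field
    coprime : Coprime (↧ₙ a) p

-- Congruence in the ring ℤₚ: both sides are required to lie in ℤₚ, and
-- their difference to lie in the ideal p ℤₚ.
infix 4 _≡_[mod_]
_≡_[mod_] : ℚ → ℚ → ℕ → Set
a ≡ b [mod p ] =
  Integral p a × Integral p b × ∃ λ z → Integral p z × a - b ≡ fromℕ p * z

legendreDenominator : ℕ → ℕ → ℕ
legendreDenominator n k = k ! ℕ.* (n ∸ k) ! ℕ.* (n ∸ 2 ℕ.* k) !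

legendreDenominator≢0 : ∀ n k → ℕ.NonZero (legendreDenominator n k)
legendreDenominator≢0 n k =
  ℕₚ.m*n≢0 _ _ {{k ℕₚ.!* (n ∸ k) !≢0}} {{(n ∸ 2 ℕ.* k) ℕₚ.!≢0}}

-- (-1)ᵏ (2n-2k)! / (k! (n-k)! (n-2k)!) · xⁿ⁻²ᵏ.  Only used for 2k ≤ n,
-- so the subtractions are never truncated.
legendreTerm : ℕ → ℚ → ℕ → ℚ
legendreTerm n x k =
  ((- 1ℚ) ^ k * (+ ((2 ℕ.* n ∸ 2 ℕ.* k) !) / legendreDenominator n k))
    * x ^ (n ∸ 2 ℕ.* k)
  where instance _ = legendreDenominator≢0 n k

-- The Legendre polynomial Pₙ, by its explicit formula
-- 2⁻ⁿ Σ_{0 ≤ k ≤ ⌊n/2⌋}, evaluated at x.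
P : ℕ → ℚ → ℚ
P n x = ½ ^ n * sum {suc ⌊ n /2⌋} (λ k → legendreTerm n x (toℕ k))

integral? : ∀ p a → Dec (Integral p a)
integral? p a = map′ integral Integral.coprime (coprime? (↧ₙ a) p)

private
  p*q≡r : ∀ p .{{_ : NonZero p}} r → p * (1/ p * r) ≡ r
  p*q≡r p r = trans (sym (*-assoc p (1/ p) r))
                (trans (cong (_* r) (*-inverseʳ p)) (*-identityˡ r))

  q≡1/p*r : ∀ p .{{_ : NonZero p}} q r → r ≡ p * q → q ≡ 1/ p * r
  q≡1/p*r p q r refl = sym (trans (sym (*-assoc (1/ p) p q))
                         (trans (cong (_* q) (*-inverseˡ p)) (*-identityˡ q)))

  multiple? : ∀ p d → Dec (∃ λ z → Integral p z × d ≡ fromℕ p * z)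
  multiple? 0 d = map′
    (λ d≡0 → 0ℚ , integral (1-coprimeTo 0) , d≡0)
    (λ (z , _ , d≡0z) → trans d≡0z (*-zeroˡ z))
    (d ≟ 0ℚ)
  multiple? p@(suc _) d = map′
    (λ i → _ , i , sym (p*q≡r (fromℕ p) d))
    (λ { (z , i , eq) → helper z i eq })
    (integral? p (1/ (fromℕ p) * d))
    where
    instance
      p≢0 : NonZero (fromℕ p)
      p≢0 = pos⇒nonZero (fromℕ p) {{normalize-pos p 1}}
    helper : ∀ z → Integral p z → d ≡ fromℕ p * z → Integral p (1/ (fromℕ p) * d)
    helper z i eq rewrite sym (q≡1/p*r (fromℕ p) z d eq) = i

_≡?_[mod_] : ∀ a b p → Dec (a ≡ b [mod p ])
a ≡? b [mod p ] = integral? p a ×-dec integral? p b ×-dec multiple? p (a - b)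

-- The r ∈ {0, …, p-1} with a ≡ r (mod p).  Such an r exists, and is
-- unique, for every a ∈ ℤₚ; the value 0 in the second case is a dummy,
-- taken only when a ∉ ℤₚ.
residue : ℕ → ℚ → ℕ
residue p a with any? (λ (r : Fin p) → a ≡? fromℕ (toℕ r) [mod p ])
... | yes (r , _) = toℕ r
... | no  _       = 0

-- b ranges over a complete residue system, so the second test decides
-- whether a is a square modulo p.
legendreℤ : ℤ → ℕ → ℤ
legendreℤ a p =
  if does (+ p ∣ℤ? a) then + 0
  else if does (any? λ (b : Fin p) → + p ∣ℤ? (+ toℕ b ℤ.* + toℕ b ℤ.- a)) then + 1
  else ℤ.- + 1

legendre : ℚ → ℕ → ℤ
legendre a p = legendreℤ (+ residue p a) p

1+x-nonZero : ∀ p {x} → Integral p x → ¬ (x ≡ - 1ℚ [mod p ]) → NonZero (1ℚ + x)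
1+x-nonZero p {x} x∈ℤₚ x≢-1 = ≢-nonZero λ 1+x≡0 →
  x≢-1 (x∈ℤₚ , integral (1-coprimeTo p) , 0ℚ , integral (1-coprimeTo p) ,
        trans (trans (+-comm x 1ℚ) 1+x≡0) (sym (*-zeroʳ (fromℕ p))))

{-# OPTIONS --safe #-}

-- Put n = (p - 1)/2 and let K(a, b) = Σ C(n,k) aᵏ C(n,n-k) bⁿ⁻ᵏ, the coefficient
-- of tⁿ in ((1 + at)(1 + bt))ⁿ.  Expanding the same power as
-- ((1 + xt)² - t²)ⁿ gives 2ⁿ Pₙ(x) = K(x - 1, x + 1), and expanding it as
-- ((1 + at)² + dt(1 + at))ⁿ gives K(a, a + d) = Σ C(n,k) C(n+k,k) aᵏ dⁿ⁻ᵏ.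
-- Since C(n+k,k) ≡ (-1)ᵏ C(n,k) (mod p), the latter is congruent to K(-a, d).
-- For y = (3 - x)/(1 + x) we have (1 + x)(1 - y) = 2(x - 1), so by homogeneity
--   (1 + x)ⁿ 2ⁿ Pₙ(y) ≡ (1 + x)ⁿ K(1 - y, 2) = 2ⁿ K(x - 1, x + 1) = 4ⁿ Pₙ(x),
-- and Fermat's theorem and Euler's criterion finish the proof.

module Submission where

open import Algebra.Bundles using (CommutativeRing; CommutativeSemiring)
import Algebra.Structures.Biased as Biased
open import Data.Bool.Base using (if_then_else_)
open import Data.Fin.Base as Fin using (Fin; toℕ; fromℕ<; inject₁)
open import Data.Fin.Properties as Finₚ using (toℕ<n; toℕ-fromℕ<; any?)
open import Data.Integer.Base as ℤ using (ℤ; +_; -[1+_]; 0ℤ; 1ℤ; -1ℤ)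
open import Data.Integer.DivMod using (a≡a%ℕn+[a/ℕn]*n; n%ℕd<d)
open import Data.Integer.Divisibility.Signed
  using (divides; ∣ᵤ⇒∣; ∣⇒∣ᵤ; ∣-refl; ∣m∣n⇒∣m+n; ∣m∣n⇒∣m-n; ∣n⇒∣m*n; ∣m⇒∣m*n)
  renaming (_∣_ to _∣ℤ_; _∣?_ to _∣ℤ?_)
import Data.Integer.Properties as ℤₚ
import Data.Integer.Tactic.RingSolver as ℤ-Solver
open import Data.Nat.Base as ℕ using (ℕ; zero; suc; _∸_; ⌊_/2⌋; _!)
open import Data.Nat.Combinatorics
  using (_C_; nCk+nC[k+1]≡[n+1]C[k+1]; nCn≡1; k>n⇒nCk≡0; nCk≡nC[n∸k]; nCk≡n!/k![n-k]!; k![n∸k]!∣n!)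
open import Data.Nat.Coprimality as Coprimality using (Coprime; 1-coprimeTo; coprime-divisor)
import Data.Nat.DivMod as ℕ÷
open import Data.Nat.Divisibility using (_∣_)
import Data.Nat.Divisibility as ℕ∣
open import Data.Nat.Primality
  using (Prime; ¬prime[1]; euclidsLemma; prime⇒irreducible; prime⇒nonZero; prime⇒nonTrivial)
import Data.Nat.Properties as ℕₚ
import Data.Nat.Tactic.RingSolver as ℕ-Solver
open import Data.Product.Base using (∃; _,_)
open import Data.Sum.Base as Sum using (_⊎_; inj₁; inj₂)
open import Data.Vec.Base using (Vec; []; _∷_; replicate)
open import Function.Base using (_∘_)
open import Relation.Binary.PropositionalEquality as ≡ using (_≡_)
open import Relation.Nullary.Decidable.Core using (Dec; yes; no; does; dec⇒maybe)
open import Relation.Nullary.Negation.Core using (¬_; contradiction)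

-- Formal power series

-- The argument (3 - x)/(1 + x) is forced by the reflection `central-reflect`. That congruence turns
-- the pair (y - 1, y + 1) into (1 - y, 2), and K is homogeneous, so y is chosen to make (1 - y) : 2
-- equal to (x - 1) : (x + 1). The common factors are 1 + x on one side and 2 on the other, and
-- their n-th powers need not cancel. One more factor 2ⁿ turns the multiplier of Pₙ(x) into 4ⁿ =
-- 2^(p-1), which is 1 modulo p, and that of Pₙ(y) into (2(1 + x))ⁿ, which is the Legendre symbol by
-- Euler's criterion. The symbol is evaluated on a residue found by search. Euler's criterion is
-- therefore proved for integers and carried over to ℤₚ once every element is known to have a
-- residue; Fermat's theorem supplies this by inverting denominators modulo p.

k≤⌊n/2⌋⇒k*2≤n : ∀ {k} n → k ℕ.≤ ℕ.⌊ n /2⌋ → k ℕ.* 2 ℕ.≤ n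
k≤⌊n/2⌋⇒k*2≤n {zero}  n             _             = ℕ.z≤n
k≤⌊n/2⌋⇒k*2≤n {suc k} (suc (suc n)) (ℕ.s≤s k≤n/2) = ℕ.s≤s (ℕ.s≤s (k≤⌊n/2⌋⇒k*2≤n n k≤n/2))

⌊n/2⌋<k⇒n<k*2 : ∀ {k} n → ℕ.⌊ n /2⌋ ℕ.< k → n ℕ.< k ℕ.* 2
⌊n/2⌋<k⇒n<k*2 zero          (ℕ.s≤s _)     = ℕ.s≤s ℕ.z≤n
⌊n/2⌋<k⇒n<k*2 (suc zero)    (ℕ.s≤s _)     = ℕ.s≤s (ℕ.s≤s ℕ.z≤n)
⌊n/2⌋<k⇒n<k*2 (suc (suc n)) (ℕ.s≤s n/2<k) = ℕ.s≤s (ℕ.s≤s (⌊n/2⌋<k⇒n<k*2 n n/2<k))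

module PowerSeries {c ℓ} (R : CommutativeSemiring c ℓ) where

  open CommutativeSemiring R
  open import Algebra.Definitions.RawSemiring rawSemiring using (sum; _×_; _^_)
  open import Algebra.Properties.CommutativeSemigroup +-commutativeSemigroup
    using (interchange; x∙yz≈y∙xz)
  open import Algebra.Properties.Monoid.Mult +-monoid using (×-congʳ; ×-congˡ; ×-homo-+)
  open import Algebra.Properties.Semiring.Mult semiring using (×-comm-*)
  open import Algebra.Properties.Monoid.Sum +-monoid using (sum-cong-≋; sum-replicate-zero)
  open import Relation.Binary.Reasoning.Setoid setoid

  Series : Set c
  Series = ℕ → Carrier

  infix  4 _≋_
  infixl 6 _⊕_
  infixl 7 _⊛_

  _≋_ : Series → Series → Set ℓ
  f ≋ g = ∀ n → f n ≈ g n

  _⊕_ : Series → Series → Series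
  (f ⊕ g) n = f n + g n

  tail : Series → Series
  tail f n = f (suc n)

  -- The Cauchy product, by recursion on the index: splitting off `f 0` leaves a product with
  -- `tail f`. The semiring laws then follow by induction on the index, without reindexing double
  -- sums; `⊛-coefficient` recovers the usual sum.
  _⊛_ : Series → Series → Series
  (f ⊛ g) zero    = f 0 * g 0
  (f ⊛ g) (suc n) = f 0 * g (suc n) + (tail f ⊛ g) n

  shift : Series → Series
  shift f zero    = 0#
  shift f (suc n) = f n

  monomial : Carrier → ℕ → Series
  monomial a zero    zero    = a
  monomial a zero    (suc n) = 0#
  monomial a (suc k) = shift (monomial a k)

  linear : Carrier → Series
  linear a = monomial 1# 0 ⊕ monomial a 1

  ⊛-cong : ∀ {f f′ g g′} → f ≋ f′ → g ≋ g′ → f ⊛ g ≋ f′ ⊛ g′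
  ⊛-cong p q zero    = *-cong (p 0) (q 0)
  ⊛-cong p q (suc n) = +-cong (*-cong (p 0) (q (suc n))) (⊛-cong (λ i → p (suc i)) q n)

  ⊛-zeroˡ : ∀ f → (λ _ → 0#) ⊛ f ≋ (λ _ → 0#)
  ⊛-zeroˡ f zero    = zeroˡ (f 0)
  ⊛-zeroˡ f (suc n) = trans (+-cong (zeroˡ _) (⊛-zeroˡ f n)) (+-identityˡ 0#)

  constant-⊛ : ∀ a f n → (monomial a 0 ⊛ f) n ≈ a * f n
  constant-⊛ a f zero    = refl
  constant-⊛ a f (suc n) = trans (+-congˡ (⊛-zeroˡ f n)) (+-identityʳ _)

  ⊛-identityˡ : ∀ f → monomial 1# 0 ⊛ f ≋ f
  ⊛-identityˡ f n = trans (constant-⊛ 1# f n) (*-identityˡ (f n))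

  ⊛-distribʳ : ∀ f g h → (g ⊕ h) ⊛ f ≋ g ⊛ f ⊕ h ⊛ f
  ⊛-distribʳ f g h zero    = distribʳ _ _ _
  ⊛-distribʳ f g h (suc n) =
    trans (+-cong (distribʳ _ _ _) (⊛-distribʳ f (tail g) (tail h) n)) (interchange _ _ _ _)

  -- The recursion of `_⊛_` treats its factors asymmetrically. This is the mirror-image recursion,
  -- peeling the right factor, from which commutativity follows.
  ⊛-tailʳ : ∀ f g n → (f ⊛ g) (suc n) ≈ f (suc n) * g 0 + (f ⊛ tail g) n
  ⊛-tailʳ f g zero    = +-comm _ _
  ⊛-tailʳ f g (suc n) = begin
    f 0 * g (suc (suc n)) + (tail f ⊛ g) (suc n)
      ≈⟨ +-congˡ (⊛-tailʳ (tail f) g n) ⟩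
    f 0 * g (suc (suc n)) + (f (suc (suc n)) * g 0 + (tail f ⊛ tail g) n)
      ≈⟨ x∙yz≈y∙xz _ _ _ ⟩
    f (suc (suc n)) * g 0 + (f 0 * g (suc (suc n)) + (tail f ⊛ tail g) n) ∎

  ⊛-comm : ∀ f g → f ⊛ g ≋ g ⊛ f
  ⊛-comm f g zero    = *-comm _ _
  ⊛-comm f g (suc n) = begin
    f 0 * g (suc n) + (tail f ⊛ g) n ≈⟨ +-cong (*-comm _ _) (⊛-comm (tail f) g n) ⟩
    g (suc n) * f 0 + (g ⊛ tail f) n ≈⟨ ⊛-tailʳ g f n ⟨
    (g ⊛ f) (suc n)                  ∎

  scale-⊛ : ∀ a f g n → ((λ i → a * f i) ⊛ g) n ≈ a * (f ⊛ g) n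
  scale-⊛ a f g zero    = *-assoc _ _ _
  scale-⊛ a f g (suc n) =
    trans (+-cong (*-assoc _ _ _) (scale-⊛ a (tail f) g n)) (sym (distribˡ _ _ _))

  ⊛-assoc : ∀ f g h → (f ⊛ g) ⊛ h ≋ f ⊛ (g ⊛ h)
  ⊛-assoc f g h zero    = *-assoc _ _ _
  ⊛-assoc f g h (suc n) = begin
    f 0 * g 0 * h (suc n) + (((λ i → f 0 * g (suc i)) ⊕ tail f ⊛ g) ⊛ h) n
      ≈⟨ +-cong (*-assoc _ _ _) (⊛-distribʳ h _ (tail f ⊛ g) n) ⟩
    f 0 * (g 0 * h (suc n)) + (((λ i → f 0 * g (suc i)) ⊛ h) n + ((tail f ⊛ g) ⊛ h) n)
      ≈⟨ +-congˡ (+-cong (scale-⊛ (f 0) (tail g) h n) (⊛-assoc (tail f) g h n)) ⟩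
    f 0 * (g 0 * h (suc n)) + (f 0 * (tail g ⊛ h) n + (tail f ⊛ (g ⊛ h)) n)
      ≈⟨ +-assoc _ _ _ ⟨
    f 0 * (g 0 * h (suc n)) + f 0 * (tail g ⊛ h) n + (tail f ⊛ (g ⊛ h)) n
      ≈⟨ +-congʳ (distribˡ _ _ _) ⟨
    f 0 * (g ⊛ h) (suc n) + (tail f ⊛ (g ⊛ h)) n ∎

  -- With this structure the binomial theorem and the laws of exponents apply to series themselves.
  series : CommutativeSemiring c ℓ
  series = record
    { isCommutativeSemiring = Biased.isCommutativeSemiringˡ record
      { +-isCommutativeMonoid = record
        { isMonoid = record
          { isSemigroup = record
            { isMagma = record
              { isEquivalence = record
                { refl  = λ _ → refl
                ; sym   = λ p n → sym (p n)
                ; trans = λ p q n → trans (p n) (q n)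
                }
              ; ∙-cong = λ p q n → +-cong (p n) (q n)
              }
            ; assoc = λ f g h n → +-assoc (f n) (g n) (h n)
            }
          ; identity = (λ f n → +-identityˡ (f n)) , (λ f n → +-identityʳ (f n))
          }
        ; comm = λ f g n → +-comm (f n) (g n)
        }
      ; *-isCommutativeMonoid = record
        { isMonoid = record
          { isSemigroup = record
            { isMagma = record
              { isEquivalence = record
                { refl  = λ _ → refl
                ; sym   = λ p n → sym (p n)
                ; trans = λ p q n → trans (p n) (q n)
                }
              ; ∙-cong = ⊛-cong
              }
            ; assoc = ⊛-assoc
            }
          ; identity = ⊛-identityˡ
                     , λ f n → trans (⊛-comm f (monomial 1# 0) n) (⊛-identityˡ f n)
          }
        ; comm = ⊛-comm
        }
      ; distribʳ = ⊛-distribʳ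
      ; zeroˡ    = ⊛-zeroˡ
      }
    }

  private module S = CommutativeSemiring series
  open import Algebra.Properties.CommutativeSemiring.Binomial series as Binomial using ()
  open import Algebra.Definitions.RawSemiring S.rawSemiring
    using () renaming (_^_ to _⊛^_; _×_ to _⊙_; sum to ⊕-sum)
  open import Algebra.Properties.CommutativeSemiring.Exp series
    using () renaming (^-distrib-* to ⊛^-distrib-⊛; ^-congˡ to ⊛^-congˡ; ^-homo-* to ⊛^-homo; ^-assocʳ to ⊛^-assoc)

  open import Algebra.Properties.Semiring.Sum S.semiring
    using () renaming (*-distribˡ-sum to *-distribˡ-⊕-sum)
  open import Algebra.Properties.Semiring.Mult S.semiring
    using () renaming (×-comm-* to ⊙-comm-⊛)

  ⊛-coefficient : ∀ f g n → (f ⊛ g) n ≈ sum {suc n} (λ k → f (toℕ k) * g (n ∸ toℕ k))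
  ⊛-coefficient f g zero    = sym (+-identityʳ _)
  ⊛-coefficient f g (suc n) = +-congˡ (⊛-coefficient (tail f) g n)

  ⊕-sum-coefficient : ∀ {m} (f : Fin m → Series) n → ⊕-sum f n ≈ sum (λ i → f i n)
  ⊕-sum-coefficient {zero}  f n = refl
  ⊕-sum-coefficient {suc m} f n = +-congˡ (⊕-sum-coefficient (λ i → f (Fin.suc i)) n)

  ⊙-coefficient : ∀ m f n → (m ⊙ f) n ≈ m × f n
  ⊙-coefficient zero    f n = refl
  ⊙-coefficient (suc m) f n = +-congˡ (⊙-coefficient m f n)

  shift-⊛ : ∀ f g → shift f ⊛ g ≋ shift (f ⊛ g)
  shift-⊛ f g zero    = zeroˡ _
  shift-⊛ f g (suc n) = trans (+-congʳ (zeroˡ _)) (+-identityˡ _)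

  shift-cong : ∀ {f g} → f ≋ g → shift f ≋ shift g
  shift-cong p zero    = refl
  shift-cong p (suc n) = p n

  monomial-⊛-+ : ∀ a j f n → (monomial a j ⊛ f) (j ℕ.+ n) ≈ a * f n
  monomial-⊛-+ a zero    f n = constant-⊛ a f n
  monomial-⊛-+ a (suc j) f n =
    trans (shift-⊛ (monomial a j) f (suc (j ℕ.+ n))) (monomial-⊛-+ a j f n)

  monomial-⊛-< : ∀ a j f {n} → n ℕ.< j → (monomial a j ⊛ f) n ≈ 0#
  monomial-⊛-< a (suc j) f {zero}  _             = zeroˡ _
  monomial-⊛-< a (suc j) f {suc n} (ℕ.s≤s n<j) =
    trans (shift-⊛ (monomial a j) f (suc n)) (monomial-⊛-< a j f n<j)

  monomial-⊛-≥ : ∀ a {j} f {n} → j ℕ.≤ n → (monomial a j ⊛ f) n ≈ a * f (n ∸ j)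
  monomial-⊛-≥ a {j} f {n} j≤n =
    ≡.subst (λ m → (monomial a j ⊛ f) m ≈ a * f (n ∸ j)) (ℕₚ.m+[n∸m]≡n j≤n)
      (monomial-⊛-+ a j f (n ∸ j))

  scale-monomial : ∀ a b j n → a * monomial b j n ≈ monomial (a * b) j n
  scale-monomial a b zero    zero    = refl
  scale-monomial a b zero    (suc n) = zeroʳ a
  scale-monomial a b (suc j) zero    = zeroʳ a
  scale-monomial a b (suc j) (suc n) = scale-monomial a b j n

  monomial-⊛-monomial : ∀ a i b j → monomial a i ⊛ monomial b j ≋ monomial (a * b) (i ℕ.+ j)
  monomial-⊛-monomial a zero    b j n = trans (constant-⊛ a (monomial b j) n) (scale-monomial a b j n)
  monomial-⊛-monomial a (suc i) b j n =
    trans (shift-⊛ (monomial a i) (monomial b j) n) (shift-cong (monomial-⊛-monomial a i b j) n)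

  monomial-^ : ∀ a j k → monomial a j ⊛^ k ≋ monomial (a ^ k) (k ℕ.* j)
  monomial-^ a j zero    n = refl
  monomial-^ a j (suc k) n =
    trans (⊛-cong {monomial a j} (λ _ → refl) (monomial-^ a j k) n) (monomial-⊛-monomial a j (a ^ k) (k ℕ.* j) n)

  linear-⊛-suc : ∀ a f n → (linear a ⊛ f) (suc n) ≈ f (suc n) + a * f n
  linear-⊛-suc a f n = begin
    (linear a ⊛ f) (suc n)
      ≈⟨ ⊛-distribʳ f (monomial 1# 0) (monomial a 1) (suc n) ⟩
    (monomial 1# 0 ⊛ f) (suc n) + (monomial a 1 ⊛ f) (suc n)
      ≈⟨ +-cong (⊛-identityˡ f (suc n)) (monomial-⊛-+ a 1 f n) ⟩
    f (suc n) + a * f n ∎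

  -- Multiplication by 1 + at acts on coefficients as Pascal's rule does, so induction on `m`
  -- suffices; beyond degree `m` both sides vanish.
  linear-^ : ∀ a m k → (linear a ⊛^ m) k ≈ (m C k) × a ^ k
  linear-^ a zero    zero    = sym (+-identityʳ 1#)
  linear-^ a zero    (suc k) = refl
  linear-^ a (suc m) zero    = begin
    (1# + 0#) * (linear a ⊛^ m) 0 ≈⟨ *-congʳ (+-identityʳ 1#) ⟩
    1# * (linear a ⊛^ m) 0        ≈⟨ *-identityˡ _ ⟩
    (linear a ⊛^ m) 0             ≈⟨ linear-^ a m 0 ⟩
    (m C 0) × 1#                  ∎
  linear-^ a (suc m) (suc k) = begin
    (linear a ⊛ linear a ⊛^ m) (suc k)
      ≈⟨ linear-⊛-suc a (linear a ⊛^ m) k ⟩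
    (linear a ⊛^ m) (suc k) + a * (linear a ⊛^ m) k
      ≈⟨ +-cong (linear-^ a m (suc k)) (*-congˡ (linear-^ a m k)) ⟩
    (m C suc k) × a ^ suc k + a * ((m C k) × a ^ k)
      ≈⟨ +-congˡ (×-comm-* (m C k) a (a ^ k)) ⟩
    (m C suc k) × a ^ suc k + (m C k) × a ^ suc k
      ≈⟨ +-comm _ _ ⟩
    (m C k) × a ^ suc k + (m C suc k) × a ^ suc k
      ≈⟨ ×-homo-+ _ (m C k) (m C suc k) ⟨
    (m C k ℕ.+ m C suc k) × a ^ suc k
      ≈⟨ ×-congˡ (nCk+nC[k+1]≡[n+1]C[k+1] m k) ⟩
    (suc m C suc k) × a ^ suc k ∎

  quadratic : Carrier → Carrier → Series
  quadratic a b 0 = 1#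
  quadratic a b 1 = a
  quadratic a b 2 = b
  quadratic a b _ = 0#

  linear-⊛-linear : ∀ a b → linear a ⊛ linear b ≋ quadratic (a + b) (a * b)
  linear-⊛-linear a b 0 = trans (*-cong (+-identityʳ _) (+-identityʳ _)) (*-identityˡ _)
  linear-⊛-linear a b 1 = begin
    (linear a ⊛ linear b) 1   ≈⟨ linear-⊛-suc a (linear b) 0 ⟩
    0# + b + a * (1# + 0#)    ≈⟨ +-cong (+-identityˡ b) (*-congˡ (+-identityʳ 1#)) ⟩
    b + a * 1#                ≈⟨ +-congˡ (*-identityʳ a) ⟩
    b + a                     ≈⟨ +-comm b a ⟩
    a + b                     ∎
  linear-⊛-linear a b 2 = begin
    (linear a ⊛ linear b) 2   ≈⟨ linear-⊛-suc a (linear b) 1 ⟩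
    0# + 0# + a * (0# + b)    ≈⟨ +-cong (+-identityˡ 0#) (*-congˡ (+-identityˡ b)) ⟩
    0# + a * b                ≈⟨ +-identityˡ _ ⟩
    a * b                     ∎
  linear-⊛-linear a b (suc (suc (suc n))) = begin
    (linear a ⊛ linear b) (3 ℕ.+ n) ≈⟨ linear-⊛-suc a (linear b) (2 ℕ.+ n) ⟩
    0# + 0# + a * (0# + 0#)         ≈⟨ +-cong (+-identityˡ 0#) (*-congˡ (+-identityˡ 0#)) ⟩
    0# + a * 0#                     ≈⟨ +-identityˡ _ ⟩
    a * 0#                          ≈⟨ zeroʳ a ⟩
    0#                              ∎

  -- K(a, b) of the overview, defined as a coefficient so that each way of expanding the same power
  -- gives a formula for it.
  central : ℕ → Carrier → Carrier → Carrier
  central n a b = ((linear a ⊛ linear b) ⊛^ n) n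

  central-product : ∀ n a b →
    central n a b ≈ sum {suc n} (λ k → (n C toℕ k) × a ^ toℕ k * ((n C (n ∸ toℕ k)) × b ^ (n ∸ toℕ k)))
  central-product n a b = begin
    ((linear a ⊛ linear b) ⊛^ n) n
      ≈⟨ ⊛^-distrib-⊛ (linear a) (linear b) n n ⟩
    (linear a ⊛^ n ⊛ linear b ⊛^ n) n
      ≈⟨ ⊛-coefficient (linear a ⊛^ n) (linear b ⊛^ n) n ⟩
    sum {suc n} (λ k → (linear a ⊛^ n) (toℕ k) * (linear b ⊛^ n) (n ∸ toℕ k))
      ≈⟨ sum-cong-≋ {suc n} (λ k → *-cong (linear-^ a n (toℕ k)) (linear-^ b n (n ∸ toℕ k))) ⟩
    sum {suc n} (λ k → (n C toℕ k) × a ^ toℕ k * ((n C (n ∸ toℕ k)) × b ^ (n ∸ toℕ k))) ∎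

  -- With L = 1 + at and T = dt the power is Lⁿ (L + T)ⁿ. Expanding only the second factor gives
  -- terms Lⁿ⁺ᵏ Tⁿ⁻ᵏ; the power of T uses up n - k of the degree, which leaves the coefficient of tᵏ
  -- in Lⁿ⁺ᵏ.
  central-shift : ∀ n a b d → b ≈ a + d →
    central n a b ≈ sum {suc n} (λ k → (n C toℕ k) × (d ^ (n ∸ toℕ k) * (((n ℕ.+ toℕ k) C toℕ k) × a ^ toℕ k)))
  central-shift n a b d b≈a+d = begin
    ((L ⊛ linear b) ⊛^ n) n
      ≈⟨ ⊛^-congˡ n (⊛-cong {L} (λ _ → refl) linear-b) n ⟩
    ((L ⊛ (L ⊕ T)) ⊛^ n) n
      ≈⟨ ⊛^-distrib-⊛ L (L ⊕ T) n n ⟩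
    (L ⊛^ n ⊛ (L ⊕ T) ⊛^ n) n
      ≈⟨ ⊛-cong {L ⊛^ n} (λ _ → refl) (Binomial.theorem n L T) n ⟩
    (L ⊛^ n ⊛ Binomial.binomialExpansion L T n) n
      ≈⟨ *-distribˡ-⊕-sum (L ⊛^ n) (Binomial.binomialTerm L T n) n ⟩
    ⊕-sum (λ k → L ⊛^ n ⊛ Binomial.binomialTerm L T n k) n
      ≈⟨ ⊕-sum-coefficient (λ k → L ⊛^ n ⊛ Binomial.binomialTerm L T n k) n ⟩
    sum {suc n} (λ k → (L ⊛^ n ⊛ Binomial.binomialTerm L T n k) n)
      ≈⟨ sum-cong-≋ {suc n} (λ k → term (toℕ k) (ℕₚ.≤-pred (toℕ<n k))) ⟩
    sum {suc n} (λ k → (n C toℕ k) × (d ^ (n ∸ toℕ k) * (((n ℕ.+ toℕ k) C toℕ k) × a ^ toℕ k))) ∎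
    where
    L = linear a
    T = monomial d 1

    linear-b : linear b ≋ L ⊕ T
    linear-b zero          = sym (+-identityʳ _)
    linear-b (suc zero)    = trans (+-congˡ b≈a+d) (sym (+-assoc _ _ _))
    linear-b (suc (suc _)) = sym (+-identityʳ _)

    rearrange : ∀ k → L ⊛^ n ⊛ (L ⊛^ k ⊛ T ⊛^ (n ∸ k)) ≋
                      monomial (d ^ (n ∸ k)) (n ∸ k) ⊛ L ⊛^ (n ℕ.+ k)
    rearrange k = S.trans (S.sym (⊛-assoc (L ⊛^ n) (L ⊛^ k) (T ⊛^ (n ∸ k))))
      (S.trans (⊛-comm (L ⊛^ n ⊛ L ⊛^ k) (T ⊛^ (n ∸ k)))
        (⊛-cong T^ (S.sym (⊛^-homo L n k))))
      where
      T^ : T ⊛^ (n ∸ k) ≋ monomial (d ^ (n ∸ k)) (n ∸ k)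
      T^ = ≡.subst (λ j → T ⊛^ (n ∸ k) ≋ monomial (d ^ (n ∸ k)) j) (ℕₚ.*-identityʳ (n ∸ k))
             (monomial-^ d 1 (n ∸ k))

    term : ∀ k → k ℕ.≤ n →
      (L ⊛^ n ⊛ ((n C k) ⊙ (L ⊛^ k ⊛ T ⊛^ (n ∸ k)))) n ≈
      (n C k) × (d ^ (n ∸ k) * (((n ℕ.+ k) C k) × a ^ k))
    term k k≤n = begin
      (L ⊛^ n ⊛ ((n C k) ⊙ (L ⊛^ k ⊛ T ⊛^ (n ∸ k)))) n
        ≈⟨ ⊙-comm-⊛ (n C k) (L ⊛^ n) (L ⊛^ k ⊛ T ⊛^ (n ∸ k)) n ⟩
      ((n C k) ⊙ (L ⊛^ n ⊛ (L ⊛^ k ⊛ T ⊛^ (n ∸ k)))) n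
        ≈⟨ ⊙-coefficient (n C k) _ n ⟩
      (n C k) × (L ⊛^ n ⊛ (L ⊛^ k ⊛ T ⊛^ (n ∸ k))) n
        ≈⟨ ×-congʳ (n C k) (rearrange k n) ⟩
      (n C k) × (monomial (d ^ (n ∸ k)) (n ∸ k) ⊛ L ⊛^ (n ℕ.+ k)) n
        ≈⟨ ×-congʳ (n C k) (monomial-⊛-≥ (d ^ (n ∸ k)) (L ⊛^ (n ℕ.+ k)) (ℕₚ.m∸n≤m n k)) ⟩
      (n C k) × (d ^ (n ∸ k) * (L ⊛^ (n ℕ.+ k)) (n ∸ (n ∸ k)))
        ≈⟨ ×-congʳ (n C k) (*-congˡ (reflexive (≡.cong (L ⊛^ (n ℕ.+ k)) (ℕₚ.m∸[m∸n]≡n k≤n)))) ⟩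
      (n C k) × (d ^ (n ∸ k) * (L ⊛^ (n ℕ.+ k)) k)
        ≈⟨ ×-congʳ (n C k) (*-congˡ (linear-^ a (n ℕ.+ k) k)) ⟩
      (n C k) × (d ^ (n ∸ k) * (((n ℕ.+ k) C k) × a ^ k)) ∎

  sum-truncate : ∀ {m n} (f : ℕ → Carrier) → m ℕ.≤ n → (∀ {k} → m ℕ.≤ k → f k ≈ 0#) →
                 sum {n} (λ k → f (toℕ k)) ≈ sum {m} (λ k → f (toℕ k))
  sum-truncate {n = n} f ℕ.z≤n f≈0 =
    trans (sum-cong-≋ {n} (λ k → f≈0 ℕ.z≤n)) (sum-replicate-zero n)
  sum-truncate f (ℕ.s≤s m≤n) f≈0 =
    +-congˡ (sum-truncate (λ k → f (suc k)) m≤n (λ m≤k → f≈0 (ℕ.s≤s m≤k)))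

  -- The hypotheses say (1 + at)(1 + bt) = (1 + xt)² + et². The summand `e` replaces a subtraction,
  -- which a semiring does not have; it becomes -1 in `P≡central`.
  central-square : ∀ n a b x e → a + b ≈ x + x → a * b ≈ x * x + e →
    central n a b ≈ sum {suc ℕ.⌊ n /2⌋} (λ k →
      (n C toℕ k) × (e ^ toℕ k * (((2 ℕ.* (n ∸ toℕ k)) C (n ∸ 2 ℕ.* toℕ k)) × x ^ (n ∸ 2 ℕ.* toℕ k))))
  central-square n a b x e a+b≈2x ab≈x²+e = begin
    ((linear a ⊛ linear b) ⊛^ n) n
      ≈⟨ ⊛^-congˡ n square n ⟩
    ((T ⊕ L ⊛^ 2) ⊛^ n) n
      ≈⟨ Binomial.theorem n T (L ⊛^ 2) n ⟩
    Binomial.binomialExpansion T (L ⊛^ 2) n n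
      ≈⟨ ⊕-sum-coefficient (Binomial.binomialTerm T (L ⊛^ 2) n) n ⟩
    sum {suc n} (λ k → Binomial.binomialTerm T (L ⊛^ 2) n k n)
      ≈⟨ sum-cong-≋ {suc n} (λ k → trans (⊙-coefficient (n C toℕ k) (T ⊛^ toℕ k ⊛ (L ⊛^ 2) ⊛^ (n ∸ toℕ k)) n) (×-congʳ (n C toℕ k) (rearrange (toℕ k) n))) ⟩
    sum {suc n} (λ k → term (toℕ k))
      -- Once 2k exceeds n, the factor t²ᵏ leaves nothing in degree n. This is the origin of the
      -- bound ⌊n/2⌋ in the Legendre formula.
      ≈⟨ sum-truncate term (ℕ.s≤s (ℕₚ.⌊n/2⌋≤n n)) vanish ⟩
    sum {suc ℕ.⌊ n /2⌋} (λ k → term (toℕ k))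
      ≈⟨ sum-cong-≋ {suc ℕ.⌊ n /2⌋} (λ k → ×-congʳ (n C toℕ k) (coefficient (toℕ k) (ℕₚ.≤-pred (toℕ<n k)))) ⟩
    _ ∎
    where
    L = linear x
    T = monomial e 2

    square : linear a ⊛ linear b ≋ T ⊕ L ⊛^ 2
    square = S.trans (linear-⊛-linear a b) (S.trans expand
      (S.+-congˡ {T} (S.sym (S.trans (S.*-congˡ {L} (S.*-identityʳ L)) (linear-⊛-linear x x)))))
      where
      expand : quadratic (a + b) (a * b) ≋ T ⊕ quadratic (x + x) (x * x)
      expand 0 = sym (+-identityˡ _)
      expand 1 = trans a+b≈2x (sym (+-identityˡ _))
      expand 2 = trans ab≈x²+e (+-comm _ _)
      expand (suc (suc (suc _))) = sym (+-identityˡ _)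

    term : ℕ → Carrier
    term k = (n C k) × (monomial (e ^ k) (k ℕ.* 2) ⊛ L ⊛^ (2 ℕ.* (n ∸ k))) n

    rearrange : ∀ k → T ⊛^ k ⊛ (L ⊛^ 2) ⊛^ (n ∸ k) ≋ monomial (e ^ k) (k ℕ.* 2) ⊛ L ⊛^ (2 ℕ.* (n ∸ k))
    rearrange k = ⊛-cong (monomial-^ e 2 k) (⊛^-assoc L 2 (n ∸ k))

    vanish : ∀ {k} → suc ℕ.⌊ n /2⌋ ℕ.≤ k → term k ≈ 0#
    vanish {k} n/2<k = trans (×-congʳ (n C k) (monomial-⊛-< (e ^ k) (k ℕ.* 2) (L ⊛^ (2 ℕ.* (n ∸ k))) (⌊n/2⌋<k⇒n<k*2 n n/2<k)))
      (×-zero (n C k))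
      where
      ×-zero : ∀ m → m × 0# ≈ 0#
      ×-zero zero = refl
      ×-zero (suc m) = trans (+-identityˡ _) (×-zero m)

    coefficient : ∀ k → k ℕ.≤ ℕ.⌊ n /2⌋ →
      (monomial (e ^ k) (k ℕ.* 2) ⊛ L ⊛^ (2 ℕ.* (n ∸ k))) n ≈
      e ^ k * (((2 ℕ.* (n ∸ k)) C (n ∸ 2 ℕ.* k)) × x ^ (n ∸ 2 ℕ.* k))
    coefficient k k≤n/2 rewrite ℕₚ.*-comm 2 k =
      trans (monomial-⊛-≥ (e ^ k) (L ⊛^ (2 ℕ.* (n ∸ k))) (k≤⌊n/2⌋⇒k*2≤n n k≤n/2))
        (*-congˡ (linear-^ x (2 ℕ.* (n ∸ k)) (n ∸ k ℕ.* 2)))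

-- Arithmetic modulo a prime

open ≡ using (refl; sym; trans; cong; cong₂; subst; module ≡-Reasoning)
open import Defs using (legendreℤ)
open import Algebra.Definitions.RawSemiring ℤ.+-*-rawSemiring
  using () renaming (_^_ to _^ℤ_; _×_ to _×ℤ_; sum to sumℤ)
open import Algebra.Properties.CommutativeSemiring.Binomial ℤₚ.+-*-commutativeSemiring as ℤ-Binomial using ()
open import Algebra.Properties.CommutativeSemiring.Exp ℤₚ.+-*-commutativeSemiring
  using () renaming (^-distrib-* to ^ℤ-distrib-*)
open import Algebra.Properties.Monoid.Sum ℤₚ.+-0-monoid
  using () renaming (sum-init-last to sumℤ-init-last)
open import Algebra.Properties.Semiring.Exp ℤₚ.+-*-semiring
  using () renaming (^-homo-* to ^ℤ-homo-*)

-- The absorption identity, by induction through Pascal's rule, so that neither factorials nor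
-- division enter.
[k+1]*[n+1]C[k+1]≡[n+1]*nCk : ∀ n k → suc k ℕ.* (suc n C suc k) ≡ suc n ℕ.* (n C k)
[k+1]*[n+1]C[k+1]≡[n+1]*nCk zero zero = refl
[k+1]*[n+1]C[k+1]≡[n+1]*nCk zero (suc k)
  rewrite k>n⇒nCk≡0 {1} {suc (suc k)} (ℕ.s≤s (ℕ.s≤s ℕ.z≤n)) = ℕₚ.*-zeroʳ (suc (suc k))
[k+1]*[n+1]C[k+1]≡[n+1]*nCk (suc n) zero
  rewrite sym (nCk+nC[k+1]≡[n+1]C[k+1] (suc n) 0) =
  trans (ℕₚ.+-identityʳ _) (cong suc (trans (sym (ℕₚ.+-identityʳ _)) ([k+1]*[n+1]C[k+1]≡[n+1]*nCk n zero)))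
[k+1]*[n+1]C[k+1]≡[n+1]*nCk (suc n) (suc k) = begin
  suc (suc k) ℕ.* (suc (suc n) C suc (suc k))
    ≡⟨ cong (suc (suc k) ℕ.*_) (nCk+nC[k+1]≡[n+1]C[k+1] (suc n) (suc k)) ⟨
  suc (suc k) ℕ.* (C₁ ℕ.+ (suc n C suc (suc k)))
    ≡⟨ ℕₚ.*-distribˡ-+ (suc (suc k)) C₁ (suc n C suc (suc k)) ⟩
  C₁ ℕ.+ suc k ℕ.* C₁ ℕ.+ suc (suc k) ℕ.* (suc n C suc (suc k))
    ≡⟨ cong₂ (λ x y → C₁ ℕ.+ x ℕ.+ y) ([k+1]*[n+1]C[k+1]≡[n+1]*nCk n k) ([k+1]*[n+1]C[k+1]≡[n+1]*nCk n (suc k)) ⟩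
  C₁ ℕ.+ suc n ℕ.* (n C k) ℕ.+ suc n ℕ.* (n C suc k)
    ≡⟨ ℕₚ.+-assoc C₁ _ _ ⟩
  C₁ ℕ.+ (suc n ℕ.* (n C k) ℕ.+ suc n ℕ.* (n C suc k))
    ≡⟨ cong (C₁ ℕ.+_) (ℕₚ.*-distribˡ-+ (suc n) (n C k) (n C suc k)) ⟨
  C₁ ℕ.+ suc n ℕ.* (n C k ℕ.+ n C suc k)
    ≡⟨ cong (λ x → C₁ ℕ.+ suc n ℕ.* x) (nCk+nC[k+1]≡[n+1]C[k+1] n k) ⟩
  suc (suc n) ℕ.* C₁ ∎
  where
  open ≡-Reasoning
  C₁ = suc n C suc k

-- This is (k+1) C(n,k+1) = (n-k) C(n,k) with the subtraction moved to the other side, which avoids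
-- truncation in ℕ.
[k+1]*nC[k+1]+[k+1]*nCk≡[n+1]*nCk : ∀ n k → suc k ℕ.* (n C suc k) ℕ.+ suc k ℕ.* (n C k) ≡ suc n ℕ.* (n C k)
[k+1]*nC[k+1]+[k+1]*nCk≡[n+1]*nCk n k = begin
  suc k ℕ.* (n C suc k) ℕ.+ suc k ℕ.* (n C k) ≡⟨ ℕₚ.+-comm (suc k ℕ.* (n C suc k)) _ ⟩
  suc k ℕ.* (n C k) ℕ.+ suc k ℕ.* (n C suc k) ≡⟨ ℕₚ.*-distribˡ-+ (suc k) (n C k) (n C suc k) ⟨
  suc k ℕ.* (n C k ℕ.+ n C suc k)             ≡⟨ cong (suc k ℕ.*_) (nCk+nC[k+1]≡[n+1]C[k+1] n k) ⟩
  suc k ℕ.* (suc n C suc k)                   ≡⟨ [k+1]*[n+1]C[k+1]≡[n+1]*nCk n k ⟩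
  suc n ℕ.* (n C k)                           ∎
  where open ≡-Reasoning

-- `legendreℤ` branches on `does`; this eliminator provides the proof or refutation behind the
-- Boolean in each branch.
if-does : ∀ {a b ℓ} {A : Set a} {B : Set b} (C : B → Set ℓ) (A? : Dec A) {x y : B} →
          (A → C x) → (¬ A → C y) → C (if does A? then x else y)
if-does C (yes a) f g = f a
if-does C (no ¬a) f g = g ¬a

×ℤ≡* : ∀ m i → m ×ℤ i ≡ + m ℤ.* i
×ℤ≡* zero    i = refl
×ℤ≡* (suc m) i = trans (cong (ℤ._+_ i) (×ℤ≡* m i)) (sym (ℤₚ.suc-* (+ m) i))

∣-sum : ∀ {m i} (f : Fin m → ℤ) → (∀ j → i ∣ℤ f j) → i ∣ℤ sumℤ f
∣-sum {zero}  f i∣f = divides 0ℤ refl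
∣-sum {suc m} f i∣f = ∣m∣n⇒∣m+n (i∣f Fin.zero) (∣-sum (f ∘ Fin.suc) (i∣f ∘ Fin.suc))

∣-^ : ∀ {i} a b k → i ∣ℤ a ℤ.- b → i ∣ℤ a ^ℤ k ℤ.- b ^ℤ k
∣-^ a b zero    i∣a-b = divides 0ℤ refl
∣-^ {i} a b (suc k) i∣a-b = subst (i ∣ℤ_) (eq a b (a ^ℤ k) (b ^ℤ k))
  (∣m∣n⇒∣m+n (∣n⇒∣m*n a (∣-^ a b k i∣a-b)) (∣m⇒∣m*n (b ^ℤ k) i∣a-b))
  where
  eq : ∀ a b c d → a ℤ.* (c ℤ.- d) ℤ.+ (a ℤ.- b) ℤ.* d ≡ a ℤ.* c ℤ.- b ℤ.* d
  eq = ℤ-Solver.solve-∀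

-- The coefficient vector c₀ ∷ … ∷ cₙ₋₁ stands for the monic polynomial
-- xⁿ + cₙ₋₁ xⁿ⁻¹ + … + c₀.
eval : ∀ {n} → Vec ℤ n → ℤ → ℤ
eval []       x = 1ℤ
eval (c ∷ cs) x = c ℤ.+ x ℤ.* eval cs x

-- Synthetic division by x - r: the coefficients are the intermediate values of Horner's scheme at
-- r. The implicit leading 1 is inherited, so the quotient is again monic.
quotient : ∀ {n} → Vec ℤ (suc n) → ℤ → Vec ℤ n
quotient (c ∷ [])         r = []
quotient (c ∷ cs@(_ ∷ _)) r = eval cs r ∷ quotient cs r

eval-quotient : ∀ {n} (cs : Vec ℤ (suc n)) r x →
  eval cs x ≡ eval cs r ℤ.+ (x ℤ.- r) ℤ.* eval (quotient cs r) x
eval-quotient (c ∷ []) r x = eq c r x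
  where
  eq : ∀ c r x → c ℤ.+ x ℤ.* 1ℤ ≡ c ℤ.+ r ℤ.* 1ℤ ℤ.+ (x ℤ.- r) ℤ.* 1ℤ
  eq = ℤ-Solver.solve-∀
eval-quotient (c ∷ cs@(_ ∷ _)) r x =
  trans (cong (λ z → c ℤ.+ x ℤ.* z) (eval-quotient cs r x))
    (eq c r x (eval cs r) (eval (quotient cs r) x))
  where
  eq : ∀ c r x e q → c ℤ.+ x ℤ.* (e ℤ.+ (x ℤ.- r) ℤ.* q) ≡ c ℤ.+ r ℤ.* e ℤ.+ (x ℤ.- r) ℤ.* (e ℤ.+ x ℤ.* q)
  eq = ℤ-Solver.solve-∀

eval-replicate-0 : ∀ n x → eval (replicate n 0ℤ) x ≡ x ^ℤ n
eval-replicate-0 zero    x = refl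
eval-replicate-0 (suc n) x = trans (ℤₚ.+-identityˡ _) (cong (x ℤ.*_) (eval-replicate-0 n x))

-- Fermat's theorem, Lagrange's bound on roots, and Euler's criterion

module ModuloPrime {p : ℕ} (p-prime : Prime p) where

  private instance
    _ = prime⇒nonZero p-prime
    _ = prime⇒nonTrivial p-prime

  euclid : ∀ a b → + p ∣ℤ a ℤ.* b → + p ∣ℤ a ⊎ + p ∣ℤ b
  euclid a b p∣ab = Sum.map ∣ᵤ⇒∣ ∣ᵤ⇒∣
    (euclidsLemma ℤ.∣ a ∣ ℤ.∣ b ∣ p-prime (subst (p ∣_) (ℤₚ.abs-* a b) (∣⇒∣ᵤ p∣ab)))

  0<m<p⇒p∤m : ∀ {m} → 0 ℕ.< m → m ℕ.< p → ¬ + p ∣ℤ + m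
  0<m<p⇒p∤m 0<m m<p p∣m = ℕ∣.>⇒∤ {{ℕ.>-nonZero 0<m}} m<p (∣⇒∣ᵤ p∣m)

  cancel : ∀ {a} b → ¬ + p ∣ℤ a → + p ∣ℤ a ℤ.* b → + p ∣ℤ b
  cancel {a} b p∤a p∣ab with euclid a b p∣ab
  ... | inj₁ p∣a = contradiction p∣a p∤a
  ... | inj₂ p∣b = p∣b

  p∤1 : ¬ + p ∣ℤ 1ℤ
  p∤1 = 0<m<p⇒p∤m (ℕ.s≤s ℕ.z≤n) (ℕ.nonTrivial⇒n>1 p)

  -- By absorption (k+1) C(p,k+1) = p C(p-1,k), and the prime p cannot divide k+1, which lies
  -- strictly between 0 and p.
  p∣pC[k+1] : ∀ k → suc k ℕ.< p → + p ∣ℤ + (p C suc k)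
  p∣pC[k+1] k k+1<p = cancel {+ suc k} (+ (p C suc k)) (0<m<p⇒p∤m (ℕ.s≤s ℕ.z≤n) k+1<p)
    (subst (+ p ∣ℤ_) (trans (cong +_ (sym absorb)) (ℤₚ.pos-* (suc k) (p C suc k))) (∣ᵤ⇒∣ (ℕ∣.m∣m*n (ℕ.pred p C k))))
    where
    absorb : suc k ℕ.* (p C suc k) ≡ p ℕ.* (ℕ.pred p C k)
    absorb = subst (λ q → suc k ℕ.* (q C suc k) ≡ q ℕ.* (ℕ.pred p C k)) (ℕₚ.suc-pred p)
               ([k+1]*[n+1]C[k+1]≡[n+1]*nCk (ℕ.pred p) k)

  freshman : ∀ x y → + p ∣ℤ (x ℤ.+ y) ^ℤ p ℤ.- (x ^ℤ p ℤ.+ y ^ℤ p)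
  freshman x y = subst (λ q → + p ∣ℤ (x ℤ.+ y) ^ℤ q ℤ.- (x ^ℤ q ℤ.+ y ^ℤ q)) (ℕₚ.suc-pred p)
    (subst (+ p ∣ℤ_) (sym difference) (∣-sum middle p∣middle))
    where
    open ≡-Reasoning
    m = ℕ.pred p

    term : ℕ → ℤ
    term k = (suc m C k) ×ℤ (x ^ℤ k ℤ.* y ^ℤ (suc m ∸ k))

    -- The terms with exponents 1 to p - 1. The two end terms are the pure powers; `inject₁` is left
    -- over from splitting off the last one.
    middle : Fin m → ℤ
    middle i = term (suc (toℕ (inject₁ i)))

    p∣middle : ∀ i → + p ∣ℤ middle i
    p∣middle i = subst (+ p ∣ℤ_) (sym (×ℤ≡* (suc m C suc (toℕ (inject₁ i))) _)) (∣m⇒∣m*n _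
      (subst (λ q → + p ∣ℤ + (q C suc (toℕ (inject₁ i)))) (sym (ℕₚ.suc-pred p))
        (p∣pC[k+1] (toℕ (inject₁ i))
          (subst (suc (toℕ (inject₁ i)) ℕ.<_) (ℕₚ.suc-pred p)
            (ℕ.s≤s (subst (ℕ._< m) (sym (Finₚ.toℕ-inject₁ i)) (toℕ<n i)))))))

    first : term 0 ≡ y ^ℤ suc m
    first = trans (ℤₚ.+-identityʳ _) (ℤₚ.*-identityˡ _)

    last : term (suc (toℕ (Fin.fromℕ m))) ≡ x ^ℤ suc m
    last = begin
      term (suc (toℕ (Fin.fromℕ m)))              ≡⟨ cong (term ∘ suc) (Finₚ.toℕ-fromℕ m) ⟩
      (suc m C suc m) ×ℤ (x ^ℤ suc m ℤ.* y ^ℤ (m ∸ m))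
        ≡⟨ cong₂ (λ c j → c ×ℤ (x ^ℤ suc m ℤ.* y ^ℤ j)) (nCn≡1 (suc m)) (ℕₚ.n∸n≡0 m) ⟩
      x ^ℤ suc m ℤ.* 1ℤ ℤ.+ 0ℤ                    ≡⟨ ℤₚ.+-identityʳ _ ⟩
      x ^ℤ suc m ℤ.* 1ℤ                           ≡⟨ ℤₚ.*-identityʳ _ ⟩
      x ^ℤ suc m                                  ∎

    difference : (x ℤ.+ y) ^ℤ suc m ℤ.- (x ^ℤ suc m ℤ.+ y ^ℤ suc m) ≡ sumℤ middle
    difference = begin
      (x ℤ.+ y) ^ℤ suc m ℤ.- (x ^ℤ suc m ℤ.+ y ^ℤ suc m)
        ≡⟨ cong (ℤ._- (x ^ℤ suc m ℤ.+ y ^ℤ suc m)) (ℤ-Binomial.theorem (suc m) x y) ⟩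
      term 0 ℤ.+ sumℤ {suc m} (λ i → term (suc (toℕ i))) ℤ.- (x ^ℤ suc m ℤ.+ y ^ℤ suc m)
        ≡⟨ cong (λ z → term 0 ℤ.+ z ℤ.- (x ^ℤ suc m ℤ.+ y ^ℤ suc m)) (sumℤ-init-last {m} (λ i → term (suc (toℕ i)))) ⟩
      term 0 ℤ.+ (sumℤ middle ℤ.+ term (suc (toℕ (Fin.fromℕ m)))) ℤ.- (x ^ℤ suc m ℤ.+ y ^ℤ suc m)
        ≡⟨ cong₂ (λ u v → u ℤ.+ (sumℤ middle ℤ.+ v) ℤ.- (x ^ℤ suc m ℤ.+ y ^ℤ suc m)) first last ⟩
      y ^ℤ suc m ℤ.+ (sumℤ middle ℤ.+ x ^ℤ suc m) ℤ.- (x ^ℤ suc m ℤ.+ y ^ℤ suc m)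
        ≡⟨ eq (x ^ℤ suc m) (y ^ℤ suc m) (sumℤ middle) ⟩
      sumℤ middle ∎
      where
      eq : ∀ u v s → v ℤ.+ (s ℤ.+ u) ℤ.- (u ℤ.+ v) ≡ s
      eq = ℤ-Solver.solve-∀

  1^k≡1 : ∀ k → 1ℤ ^ℤ k ≡ 1ℤ
  1^k≡1 zero    = refl
  1^k≡1 (suc k) = trans (ℤₚ.*-identityˡ _) (1^k≡1 k)

  a≡a%p : ∀ a → + p ∣ℤ a ℤ.- + (a ℤ.%ℕ p)
  a≡a%p a = divides (a ℤ./ℕ p) (trans (cong (ℤ._- + (a ℤ.%ℕ p)) (a≡a%ℕn+[a/ℕn]*n a p)) (eq (+ (a ℤ.%ℕ p)) (a ℤ./ℕ p) (+ p)))
    where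
    eq : ∀ r q m → r ℤ.+ q ℤ.* m ℤ.- r ≡ q ℤ.* m
    eq = ℤ-Solver.solve-∀

  fermat-+ : ∀ a → + p ∣ℤ (+ a) ^ℤ p ℤ.- + a
  fermat-+ zero    = subst (λ q → + p ∣ℤ 0ℤ ^ℤ q ℤ.- 0ℤ) (ℕₚ.suc-pred p) (divides 0ℤ refl)
  fermat-+ (suc a) = subst (+ p ∣ℤ_) eq (∣m∣n⇒∣m+n (freshman 1ℤ (+ a)) (fermat-+ a))
    where
    lemma : ∀ u v w → u ℤ.- (1ℤ ℤ.+ v) ℤ.+ (v ℤ.- w) ≡ u ℤ.- (1ℤ ℤ.+ w)
    lemma = ℤ-Solver.solve-∀
    eq : (1ℤ ℤ.+ + a) ^ℤ p ℤ.- (1ℤ ^ℤ p ℤ.+ (+ a) ^ℤ p) ℤ.+ ((+ a) ^ℤ p ℤ.- + a) ≡ (+ suc a) ^ℤ p ℤ.- + suc a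
    eq = trans (cong (λ z → (+ suc a) ^ℤ p ℤ.- (z ℤ.+ (+ a) ^ℤ p) ℤ.+ ((+ a) ^ℤ p ℤ.- + a)) (1^k≡1 p))
           (lemma ((+ suc a) ^ℤ p) ((+ a) ^ℤ p) (+ a))

  -- The induction in `fermat-+` reaches natural numbers only; a general integer is first replaced
  -- by its remainder modulo p.
  fermat : ∀ a → + p ∣ℤ a ^ℤ p ℤ.- a
  fermat a = subst (+ p ∣ℤ_) (eq (a ^ℤ p) ((+ r) ^ℤ p) a (+ r))
    (∣m∣n⇒∣m-n (∣m∣n⇒∣m+n (∣-^ a (+ r) p (a≡a%p a)) (fermat-+ r)) (a≡a%p a))
    where
    r = a ℤ.%ℕ p
    eq : ∀ u v a r → u ℤ.- v ℤ.+ (v ℤ.- r) ℤ.- (a ℤ.- r) ≡ u ℤ.- a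
    eq = ℤ-Solver.solve-∀

  -- Lagrange's theorem: a monic polynomial of degree n has no n + 1 roots distinct modulo p.
  -- Dividing out the first root leaves the others as roots of the quotient, because p does not
  -- divide their differences from it; the descent ends at the constant 1.
  root-bound : ∀ {n} (cs : Vec ℤ n) (r : Fin (suc n) → ℤ) →
    (∀ {i j} → i Fin.< j → ¬ + p ∣ℤ r j ℤ.- r i) → ¬ (∀ i → + p ∣ℤ eval cs (r i))
  root-bound []          r distinct root = p∤1 (root Fin.zero)
  root-bound cs@(_ ∷ _) r distinct root =
    root-bound (quotient cs r₀) (r ∘ Fin.suc) (λ i<j → distinct (ℕ.s≤s i<j)) λ i →
      cancel {r (Fin.suc i) ℤ.- r₀} (eval (quotient cs r₀) (r (Fin.suc i))) (distinct (ℕ.s≤s ℕ.z≤n))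
        (subst (+ p ∣ℤ_) (eq (eval-quotient cs r₀ (r (Fin.suc i))))
          (∣m∣n⇒∣m-n (root (Fin.suc i)) (root Fin.zero)))
    where
    r₀ = r Fin.zero
    eq : ∀ {u v w} → u ≡ v ℤ.+ w → u ℤ.- v ≡ w
    eq {v = v} {w} refl = lemma v w
      where
      lemma : ∀ v w → v ℤ.+ w ℤ.- v ≡ w
      lemma = ℤ-Solver.solve-∀

  module Odd (m : ℕ) (p≡2n+1 : p ≡ suc (suc m ℕ.+ suc m)) where

    -- The successor form makes aⁿ⁻¹ available as `a ^ℤ m` and gives xⁿ - 1 a constant coefficient
    -- separate from its leading one.
    n = suc m

    n<p : n ℕ.< p
    n<p = subst (n ℕ.<_) (sym p≡2n+1) (ℕ.s≤s (ℕₚ.m≤m+n n n))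

    private
      open ≡-Reasoning

      difference-of-squares : ∀ a b → a ℤ.* a ℤ.- b ℤ.* b ≡ (a ℤ.- b) ℤ.* (a ℤ.+ b)
      difference-of-squares = ℤ-Solver.solve-∀

    -- The difference factors as (j - i)((j + 1) + (i + 1)). Both factors are positive, and the
    -- larger is at most 2n, hence less than p.
    squares-distinct : ∀ {i j} → i ℕ.< j → j ℕ.< n →
      ¬ + p ∣ℤ + suc j ℤ.* + suc j ℤ.- + suc i ℤ.* + suc i
    squares-distinct {i} {j} i<j j<n p∣j²-i²
      with euclid (+ suc j ℤ.- + suc i) (+ suc j ℤ.+ + suc i) (subst (+ p ∣ℤ_) (difference-of-squares (+ suc j) (+ suc i)) p∣j²-i²)
    ... | inj₁ p∣j-i = 0<m<p⇒p∤m (ℕₚ.m<n⇒0<n∸m i<j)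
          (ℕₚ.≤-<-trans (ℕₚ.m∸n≤m j i) (ℕₚ.<-trans j<n n<p))
          (subst (+ p ∣ℤ_) (trans (ℤₚ.m-n≡m⊖n (suc j) (suc i)) (ℤₚ.⊖-≥ (ℕ.s≤s (ℕₚ.<⇒≤ i<j)))) p∣j-i)
    ... | inj₂ p∣j+i = 0<m<p⇒p∤m (ℕ.s≤s ℕ.z≤n)
          (subst (suc j ℕ.+ suc i ℕ.<_) (sym p≡2n+1) (ℕ.s≤s (ℕₚ.+-mono-≤ j<n (ℕₚ.<-trans i<j j<n)))) p∣j+i

    a^p≡a*a^n*a^n : ∀ a → a ^ℤ p ≡ a ℤ.* (a ^ℤ n ℤ.* a ^ℤ n)
    a^p≡a*a^n*a^n a = begin
      a ^ℤ p                     ≡⟨ cong (a ^ℤ_) p≡2n+1 ⟩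
      a ℤ.* a ^ℤ (n ℕ.+ n)       ≡⟨ cong (a ℤ.*_) (^ℤ-homo-* a n n) ⟩
      a ℤ.* (a ^ℤ n ℤ.* a ^ℤ n)  ∎

    a^n*a^n≡1 : ∀ a → ¬ + p ∣ℤ a → + p ∣ℤ a ^ℤ n ℤ.* a ^ℤ n ℤ.- 1ℤ
    a^n*a^n≡1 a p∤a = cancel {a} (a ^ℤ n ℤ.* a ^ℤ n ℤ.- 1ℤ) p∤a
      (subst (+ p ∣ℤ_) (trans (cong (ℤ._- a) (a^p≡a*a^n*a^n a)) (eq a (a ^ℤ n ℤ.* a ^ℤ n))) (fermat a))
      where
      eq : ∀ a b → a ℤ.* b ℤ.- a ≡ a ℤ.* (b ℤ.- 1ℤ)
      eq = ℤ-Solver.solve-∀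

    square^n≡1 : ∀ b → ¬ + p ∣ℤ b → + p ∣ℤ (b ℤ.* b) ^ℤ n ℤ.- 1ℤ
    square^n≡1 b p∤b = subst (λ z → + p ∣ℤ z ℤ.- 1ℤ) (sym (^ℤ-distrib-* b b n)) (a^n*a^n≡1 b p∤b)

    -- Otherwise xⁿ - 1 would have n + 1 roots distinct modulo p: the squares 1², ..., n² and a
    -- itself, which is congruent to none of them.
    nonresidue^n≢1 : ∀ a → (∀ (b : Fin p) → ¬ + p ∣ℤ + toℕ b ℤ.* + toℕ b ℤ.- a) → ¬ + p ∣ℤ a ^ℤ n ℤ.- 1ℤ
    nonresidue^n≢1 a nonresidue p∣a^n-1 = root-bound x^n-1 roots distinct root
      where
      -- The coefficients below the leading one, which `eval` adds implicitly.
      x^n-1 : Vec ℤ n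
      x^n-1 = -1ℤ ∷ replicate m 0ℤ

      eval-x^n-1 : ∀ x → x ^ℤ n ℤ.- 1ℤ ≡ eval x^n-1 x
      eval-x^n-1 x = trans (ℤₚ.+-comm (x ^ℤ n) -1ℤ) (cong (λ z → -1ℤ ℤ.+ x ℤ.* z) (sym (eval-replicate-0 m x)))

      roots : Fin (suc n) → ℤ
      roots Fin.zero    = a
      roots (Fin.suc i) = + suc (toℕ i) ℤ.* + suc (toℕ i)

      i+1<p : ∀ (i : Fin n) → suc (toℕ i) ℕ.< p
      i+1<p i = ℕₚ.≤-<-trans (toℕ<n i) n<p

      distinct : ∀ {i j} → i Fin.< j → ¬ + p ∣ℤ roots j ℤ.- roots i
      distinct {Fin.zero}  {Fin.suc j} _ p∣j²-a = nonresidue (fromℕ< (i+1<p j))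
        (subst (λ k → + p ∣ℤ + k ℤ.* + k ℤ.- a) (sym (Finₚ.toℕ-fromℕ< (i+1<p j))) p∣j²-a)
      distinct {Fin.suc i} {Fin.suc j} (ℕ.s≤s i<j) = squares-distinct i<j (toℕ<n j)

      root : ∀ i → + p ∣ℤ eval x^n-1 (roots i)
      root Fin.zero    = subst (+ p ∣ℤ_) (eval-x^n-1 a) p∣a^n-1
      root (Fin.suc i) = subst (+ p ∣ℤ_) (eval-x^n-1 (roots (Fin.suc i)))
        (square^n≡1 (+ suc (toℕ i)) (0<m<p⇒p∤m (ℕ.s≤s ℕ.z≤n) (i+1<p i)))

    -- In the nonresidue case aⁿ is a square root of 1 modulo p; root counting excludes 1, which
    -- leaves -1.
    euler : ∀ a → + p ∣ℤ a ^ℤ n ℤ.- legendreℤ a p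
    euler a =
      if-does (λ l → + p ∣ℤ a ^ℤ n ℤ.- l) (+ p ∣ℤ? a) divisible λ p∤a →
      if-does (λ l → + p ∣ℤ a ^ℤ n ℤ.- l) (any? (λ (b : Fin p) → + p ∣ℤ? (+ toℕ b ℤ.* + toℕ b ℤ.- a)))
        (λ (b , p∣b²-a) → residue-class (+ toℕ b) p∤a p∣b²-a)
        (λ nonresidue → nonresidue-class p∤a λ b p∣b²-a → nonresidue (b , p∣b²-a))
      where
      divisible : + p ∣ℤ a → + p ∣ℤ a ^ℤ n ℤ.- 0ℤ
      divisible p∣a = subst (+ p ∣ℤ_) (sym (ℤₚ.+-identityʳ (a ^ℤ n))) (∣m⇒∣m*n (a ^ℤ m) p∣a)

      residue-class : ∀ b → ¬ + p ∣ℤ a → + p ∣ℤ b ℤ.* b ℤ.- a → + p ∣ℤ a ^ℤ n ℤ.- 1ℤ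
      residue-class b p∤a p∣b²-a = subst (+ p ∣ℤ_) (eq ((b ℤ.* b) ^ℤ n) (a ^ℤ n))
        (∣m∣n⇒∣m-n (square^n≡1 b p∤b) (∣-^ (b ℤ.* b) a n p∣b²-a))
        where
        lemma : ∀ b a → b ℤ.* b ℤ.- (b ℤ.* b ℤ.- a) ≡ a
        lemma = ℤ-Solver.solve-∀
        p∤b : ¬ + p ∣ℤ b
        p∤b p∣b = p∤a (subst (+ p ∣ℤ_) (lemma b a) (∣m∣n⇒∣m-n (∣m⇒∣m*n b p∣b) p∣b²-a))
        eq : ∀ u v → u ℤ.- 1ℤ ℤ.- (u ℤ.- v) ≡ v ℤ.- 1ℤ
        eq = ℤ-Solver.solve-∀

      nonresidue-class : ¬ + p ∣ℤ a → (∀ (b : Fin p) → ¬ + p ∣ℤ + toℕ b ℤ.* + toℕ b ℤ.- a) →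
                         + p ∣ℤ a ^ℤ n ℤ.- -1ℤ
      nonresidue-class p∤a nonresidue = cancel {a ^ℤ n ℤ.- 1ℤ} (a ^ℤ n ℤ.- -1ℤ)
        (nonresidue^n≢1 a nonresidue)
        (subst (+ p ∣ℤ_) (difference-of-squares (a ^ℤ n) 1ℤ) (a^n*a^n≡1 a p∤a))

    -- (n+1)⋯(n+k) ≡ (-1)ᵏ n(n-1)⋯(n-k+1), since n + j ≡ -(n - j + 1).
    [n+k]Ck≡[-1]^k*nCk : ∀ k → k ℕ.≤ n → + p ∣ℤ + ((n ℕ.+ k) C k) ℤ.- -1ℤ ^ℤ k ℤ.* + (n C k)
    [n+k]Ck≡[-1]^k*nCk zero    _   = divides 0ℤ refl
    [n+k]Ck≡[-1]^k*nCk (suc k) k<n = cancel {+ suc k} _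
      (0<m<p⇒p∤m (ℕ.s≤s ℕ.z≤n) (ℕₚ.≤-<-trans k<n n<p))
      (subst (+ p ∣ℤ_) (sym recurrence)
        (∣m∣n⇒∣m+n (∣n⇒∣m*n (+ suc (n ℕ.+ k)) ([n+k]Ck≡[-1]^k*nCk k (ℕₚ.<⇒≤ k<n)))
                   (∣m⇒∣m*n (-1ℤ ^ℤ k ℤ.* + (n C k)) ∣-refl)))
      where
      s = -1ℤ ^ℤ k
      A = + ((n ℕ.+ k) C k)
      A′ = + ((n ℕ.+ suc k) C suc k)
      B = + (n C k)
      B′ = + (n C suc k)

      step-A : + suc k ℤ.* A′ ≡ + suc (n ℕ.+ k) ℤ.* A
      step-A = begin
        + suc k ℤ.* A′              ≡⟨ ℤₚ.pos-* (suc k) ((n ℕ.+ suc k) C suc k) ⟨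
        + (suc k ℕ.* ((n ℕ.+ suc k) C suc k))
          ≡⟨ cong (λ j → + (suc k ℕ.* (j C suc k))) (ℕₚ.+-suc n k) ⟩
        + (suc k ℕ.* (suc (n ℕ.+ k) C suc k))
          ≡⟨ cong +_ ([k+1]*[n+1]C[k+1]≡[n+1]*nCk (n ℕ.+ k) k) ⟩
        + (suc (n ℕ.+ k) ℕ.* ((n ℕ.+ k) C k))
          ≡⟨ ℤₚ.pos-* (suc (n ℕ.+ k)) ((n ℕ.+ k) C k) ⟩
        + suc (n ℕ.+ k) ℤ.* A ∎

      step-B : + suc k ℤ.* B′ ℤ.+ + suc k ℤ.* B ≡ + suc n ℤ.* B
      step-B = begin
        + suc k ℤ.* B′ ℤ.+ + suc k ℤ.* B
          ≡⟨ cong₂ ℤ._+_ (ℤₚ.pos-* (suc k) (n C suc k)) (ℤₚ.pos-* (suc k) (n C k)) ⟨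
        + (suc k ℕ.* (n C suc k) ℕ.+ suc k ℕ.* (n C k))
          ≡⟨ cong +_ ([k+1]*nC[k+1]+[k+1]*nCk≡[n+1]*nCk n k) ⟩
        + (suc n ℕ.* (n C k))
          ≡⟨ ℤₚ.pos-* (suc n) (n C k) ⟩
        + suc n ℤ.* B ∎

      -- Multiplication by k + 1 produces the factors n + k + 1 on `A` and n - k on `s * B`. Their
      -- sum is 2n + 1 = p, whence the last summand.
      recurrence : + suc k ℤ.* (A′ ℤ.- -1ℤ ^ℤ suc k ℤ.* B′) ≡
                   + suc (n ℕ.+ k) ℤ.* (A ℤ.- s ℤ.* B) ℤ.+ + p ℤ.* (s ℤ.* B)
      recurrence = begin
        + suc k ℤ.* (A′ ℤ.- (-1ℤ ℤ.* s) ℤ.* B′)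
          ≡⟨ expand (+ suc k) A′ s B B′ ⟩
        + suc k ℤ.* A′ ℤ.+ s ℤ.* (+ suc k ℤ.* B′ ℤ.+ + suc k ℤ.* B) ℤ.- s ℤ.* (+ suc k ℤ.* B)
          ≡⟨ cong₂ (λ u v → u ℤ.+ s ℤ.* v ℤ.- s ℤ.* (+ suc k ℤ.* B)) step-A step-B ⟩
        + suc (n ℕ.+ k) ℤ.* A ℤ.+ s ℤ.* (+ suc n ℤ.* B) ℤ.- s ℤ.* (+ suc k ℤ.* B)
          ≡⟨ collect (+ k) (+ n) s A B ⟩
        + suc (n ℕ.+ k) ℤ.* (A ℤ.- s ℤ.* B) ℤ.+ + suc (n ℕ.+ n) ℤ.* (s ℤ.* B)
          ≡⟨ cong (λ q → + suc (n ℕ.+ k) ℤ.* (A ℤ.- s ℤ.* B) ℤ.+ + q ℤ.* (s ℤ.* B)) p≡2n+1 ⟨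
        + suc (n ℕ.+ k) ℤ.* (A ℤ.- s ℤ.* B) ℤ.+ + p ℤ.* (s ℤ.* B) ∎
        where
        expand : ∀ k A′ s B B′ → k ℤ.* (A′ ℤ.- (-1ℤ ℤ.* s) ℤ.* B′) ≡
                 k ℤ.* A′ ℤ.+ s ℤ.* (k ℤ.* B′ ℤ.+ k ℤ.* B) ℤ.- s ℤ.* (k ℤ.* B)
        expand = ℤ-Solver.solve-∀
        collect : ∀ k n s A B →
          (1ℤ ℤ.+ (n ℤ.+ k)) ℤ.* A ℤ.+ s ℤ.* ((1ℤ ℤ.+ n) ℤ.* B) ℤ.- s ℤ.* ((1ℤ ℤ.+ k) ℤ.* B) ≡
          (1ℤ ℤ.+ (n ℤ.+ k)) ℤ.* (A ℤ.- s ℤ.* B) ℤ.+ (1ℤ ℤ.+ (n ℤ.+ n)) ℤ.* (s ℤ.* B)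
        collect = ℤ-Solver.solve-∀

-- The localization of ℤ at p

open import Defs
open import Data.Product.Base using (_×_)
open import Data.Rational.Base
open import Data.Rational.Properties
open import Data.Rational.Unnormalised.Base using (mkℚᵘ; *≡*)
open import Algebra.Properties.Group +-0-group using (⁻¹-involutive)
open import Tactic.RingSolver using (solve-∀)
open import Tactic.RingSolver.Core.AlmostCommutativeRing using (AlmostCommutativeRing; fromCommutativeRing)

ℚ-ring : AlmostCommutativeRing _ _
ℚ-ring = fromCommutativeRing +-*-commutativeRing (λ q → dec⇒maybe (0ℚ ≟ q))

-- `i / 1` passes through sign analysis and gcd normalisation and is stuck for a variable `i`; in
-- the explicit form numerator and denominator compute.
fromℤ≡mkℚ : ∀ i → fromℤ i ≡ mkℚ i 0 (Coprimality.sym (1-coprimeTo ℤ.∣ i ∣))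
fromℤ≡mkℚ i = ↥p/↧p≡p (mkℚ i 0 _)

fromℤ-+ : ∀ i j → fromℤ (i ℤ.+ j) ≡ fromℤ i + fromℤ j
fromℤ-+ i j rewrite fromℤ≡mkℚ i | fromℤ≡mkℚ j =
  cong fromℤ (sym (cong₂ ℤ._+_ (ℤₚ.*-identityʳ i) (ℤₚ.*-identityʳ j)))

fromℤ-* : ∀ i j → fromℤ (i ℤ.* j) ≡ fromℤ i * fromℤ j
fromℤ-* i j rewrite fromℤ≡mkℚ i | fromℤ≡mkℚ j = refl

fromℤ-neg : ∀ i → fromℤ (ℤ.- i) ≡ - fromℤ i
fromℤ-neg (+ 0)       = refl
fromℤ-neg ℤ.+[1+ n ]  = refl
fromℤ-neg (-[1+ n ])  = sym (⁻¹-involutive (normalize (suc n) 1))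

fromℤ-minus : ∀ i j → fromℤ (i ℤ.- j) ≡ fromℤ i - fromℤ j
fromℤ-minus i j = trans (fromℤ-+ i (ℤ.- j)) (cong (λ z → fromℤ i + z) (fromℤ-neg j))

fromℤ-^ : ∀ i k → fromℤ (i ^ℤ k) ≡ fromℤ i ^ k
fromℤ-^ i zero    = refl
fromℤ-^ i (suc k) = trans (fromℤ-* i (i ^ℤ k)) (cong (fromℤ i *_) (fromℤ-^ i k))

fromℤ-injective : ∀ {i j} → fromℤ i ≡ fromℤ j → i ≡ j
fromℤ-injective {i} {j} eq = cong ↥_ (trans (sym (fromℤ≡mkℚ i)) (trans eq (fromℤ≡mkℚ j)))

/≡fromℤ : ∀ i d .{{_ : ℕ.NonZero d}} q → i ≡ q ℤ.* + d → i / d ≡ fromℤ q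
/≡fromℤ i (suc d) q i≡q*d =
  fromℚᵘ-cong {mkℚᵘ i d} {mkℚᵘ q 0} (*≡* (trans (ℤₚ.*-identityʳ i) i≡q*d))

a*↧a≡↥a : ∀ a → a * fromℤ (↧ a) ≡ fromℤ (↥ a)
a*↧a≡↥a a@(mkℚ n d _) rewrite fromℤ≡mkℚ (+ suc d) =
  /≡fromℤ (n ℤ.* + suc d) (suc d ℕ.* 1) n (cong (λ e → n ℤ.* + e) (sym (ℕₚ.*-identityʳ (suc d))))

-- With the concrete motive of a≡residue, this with-abstraction would normalise
-- rational arithmetic and not terminate in practice.
residue-elim : ∀ p a (C : ℕ → Set) → (∀ (r : Fin p) → a ≡ fromℕ (toℕ r) [mod p ] → C (toℕ r)) →
  (∃ λ (r : Fin p) → a ≡ fromℕ (toℕ r) [mod p ]) → C (residue p a)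
residue-elim p a C f e with any? (λ (r : Fin p) → a ≡? fromℕ (toℕ r) [mod p ])
... | yes (r , a≡r) = f r a≡r
... | no  ∄r        = contradiction e ∄r

module _ {p : ℕ} where

  -- Any denominator prime to p will do, reduced or not, since the reduced one divides it. The
  -- closure properties of ℤₚ then require no reduction of fractions.
  integral-÷ : ∀ {a} d m → Coprime ℤ.∣ d ∣ p → a * fromℤ d ≡ fromℤ m → Integral p a
  integral-÷ {a@(mkℚ _ _ c)} d m d⊥p a*d≡m = integral λ (i∣↧a , i∣p) → d⊥p (ℕ∣.∣-trans i∣↧a ↧a∣d , i∣p)
    where
    open ≡-Reasoning
    ↥a*d≡m*↧a : ↥ a ℤ.* d ≡ m ℤ.* ↧ a
    ↥a*d≡m*↧a = fromℤ-injective (begin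
      fromℤ (↥ a ℤ.* d)             ≡⟨ fromℤ-* (↥ a) d ⟩
      fromℤ (↥ a) * fromℤ d         ≡⟨ cong (_* fromℤ d) (a*↧a≡↥a a) ⟨
      a * fromℤ (↧ a) * fromℤ d     ≡⟨ eq a (fromℤ (↧ a)) (fromℤ d) ⟩
      a * fromℤ d * fromℤ (↧ a)     ≡⟨ cong (_* fromℤ (↧ a)) a*d≡m ⟩
      fromℤ m * fromℤ (↧ a)         ≡⟨ fromℤ-* m (↧ a) ⟨
      fromℤ (m ℤ.* ↧ a)             ∎)
      where
      eq : ∀ a b c → a * b * c ≡ a * c * b
      eq = solve-∀ ℚ-ring

    ↧a∣d : ↧ₙ a ∣ ℤ.∣ d ∣
    ↧a∣d = coprime-divisor (Coprimality.sym (Coprimality.recompute c)) (ℕ∣.divides ℤ.∣ m ∣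
      (trans (sym (ℤₚ.abs-* (↥ a) d)) (trans (cong ℤ.∣_∣ ↥a*d≡m*↧a) (ℤₚ.abs-* m (↧ a)))))

  coprime-* : ∀ {m n} → Coprime m p → Coprime n p → Coprime (m ℕ.* n) p
  coprime-* m⊥p n⊥p (i∣m*n , i∣p) = n⊥p
    (coprime-divisor (λ (j∣i , j∣m) → m⊥p (j∣m , ℕ∣.∣-trans j∣i i∣p)) i∣m*n , i∣p)

  ↧*↧-coprime : ∀ {a b} → Integral p a → Integral p b → Coprime ℤ.∣ ↧ a ℤ.* ↧ b ∣ p
  ↧*↧-coprime {a} {b} (integral a⊥p) (integral b⊥p) =
    subst (λ d → Coprime d p) (sym (ℤₚ.abs-* (↧ a) (↧ b))) (coprime-* a⊥p b⊥p)

  integral-fromℤ : ∀ i → Integral p (fromℤ i)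
  integral-fromℤ i = integral-÷ 1ℤ i (1-coprimeTo p) (*-identityʳ (fromℤ i))

  integral-+ : ∀ {a b} → Integral p a → Integral p b → Integral p (a + b)
  integral-+ {a} {b} a∈ b∈ = integral-÷ (↧ a ℤ.* ↧ b) (↥ a ℤ.* ↧ b ℤ.+ ↥ b ℤ.* ↧ a) (↧*↧-coprime a∈ b∈) (begin
    (a + b) * fromℤ (↧ a ℤ.* ↧ b)
      ≡⟨ cong ((a + b) *_) (fromℤ-* (↧ a) (↧ b)) ⟩
    (a + b) * (fromℤ (↧ a) * fromℤ (↧ b))
      ≡⟨ eq a b (fromℤ (↧ a)) (fromℤ (↧ b)) ⟩
    a * fromℤ (↧ a) * fromℤ (↧ b) + b * fromℤ (↧ b) * fromℤ (↧ a)
      ≡⟨ cong₂ (λ u v → u * fromℤ (↧ b) + v * fromℤ (↧ a)) (a*↧a≡↥a a) (a*↧a≡↥a b) ⟩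
    fromℤ (↥ a) * fromℤ (↧ b) + fromℤ (↥ b) * fromℤ (↧ a)
      ≡⟨ cong₂ _+_ (fromℤ-* (↥ a) (↧ b)) (fromℤ-* (↥ b) (↧ a)) ⟨
    fromℤ (↥ a ℤ.* ↧ b) + fromℤ (↥ b ℤ.* ↧ a)
      ≡⟨ fromℤ-+ (↥ a ℤ.* ↧ b) (↥ b ℤ.* ↧ a) ⟨
    fromℤ (↥ a ℤ.* ↧ b ℤ.+ ↥ b ℤ.* ↧ a) ∎)
    where
    open ≡-Reasoning
    eq : ∀ a b c d → (a + b) * (c * d) ≡ a * c * d + b * d * c
    eq = solve-∀ ℚ-ring

  integral-* : ∀ {a b} → Integral p a → Integral p b → Integral p (a * b)
  integral-* {a} {b} a∈ b∈ = integral-÷ (↧ a ℤ.* ↧ b) (↥ a ℤ.* ↥ b) (↧*↧-coprime a∈ b∈) (begin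
    a * b * fromℤ (↧ a ℤ.* ↧ b)             ≡⟨ cong (a * b *_) (fromℤ-* (↧ a) (↧ b)) ⟩
    a * b * (fromℤ (↧ a) * fromℤ (↧ b))     ≡⟨ eq a b (fromℤ (↧ a)) (fromℤ (↧ b)) ⟩
    a * fromℤ (↧ a) * (b * fromℤ (↧ b))     ≡⟨ cong₂ _*_ (a*↧a≡↥a a) (a*↧a≡↥a b) ⟩
    fromℤ (↥ a) * fromℤ (↥ b)               ≡⟨ fromℤ-* (↥ a) (↥ b) ⟨
    fromℤ (↥ a ℤ.* ↥ b)                     ∎)
    where
    open ≡-Reasoning
    eq : ∀ a b c d → a * b * (c * d) ≡ a * c * (b * d)
    eq = solve-∀ ℚ-ring

  integral-neg : ∀ {a} → Integral p a → Integral p (- a)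
  integral-neg {a} (integral a⊥p) = integral (subst (λ d → Coprime d p) (cong ℤ.∣_∣ (sym (↧-neg a))) a⊥p)

  integral-^ : ∀ {a} k → Integral p a → Integral p (a ^ k)
  integral-^ zero    a∈ = integral-fromℤ 1ℤ
  integral-^ (suc k) a∈ = integral-* a∈ (integral-^ k a∈)

  integral-sum : ∀ {m} {f : Fin m → ℚ} → (∀ i → Integral p (f i)) → Integral p (sum f)
  integral-sum {zero}  f∈ = integral-fromℤ 0ℤ
  integral-sum {suc m} f∈ = integral-+ (f∈ Fin.zero) (integral-sum (f∈ ∘ Fin.suc))

  mod-reflexive : ∀ {a b} → Integral p a → a ≡ b → a ≡ b [mod p ]
  mod-reflexive {a} a∈ refl =
    a∈ , a∈ , 0ℚ , integral-fromℤ 0ℤ , trans (+-inverseʳ a) (sym (*-zeroʳ (fromℕ p)))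

  mod-refl : ∀ {a} → Integral p a → a ≡ a [mod p ]
  mod-refl a∈ = mod-reflexive a∈ refl

  mod-sym : ∀ {a b} → a ≡ b [mod p ] → b ≡ a [mod p ]
  mod-sym {a} {b} (a∈ , b∈ , z , z∈ , a-b≡pz) = b∈ , a∈ , - z , integral-neg z∈ ,
    trans (eq a b) (trans (cong -_ a-b≡pz) (neg-distribʳ-* (fromℕ p) z))
    where
    eq : ∀ a b → b - a ≡ - (a - b)
    eq = solve-∀ ℚ-ring

  mod-trans : ∀ {a b c} → a ≡ b [mod p ] → b ≡ c [mod p ] → a ≡ c [mod p ]
  mod-trans {a} {b} {c} (a∈ , _ , y , y∈ , a-b≡py) (_ , c∈ , z , z∈ , b-c≡pz) =
    a∈ , c∈ , y + z , integral-+ y∈ z∈ ,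
    trans (eq a b c) (trans (cong₂ _+_ a-b≡py b-c≡pz) (sym (*-distribˡ-+ (fromℕ p) y z)))
    where
    eq : ∀ a b c → a - c ≡ (a - b) + (b - c)
    eq = solve-∀ ℚ-ring

  mod-+ : ∀ {a b c d} → a ≡ b [mod p ] → c ≡ d [mod p ] → a + c ≡ b + d [mod p ]
  mod-+ {a} {b} {c} {d} (a∈ , b∈ , y , y∈ , a-b≡py) (c∈ , d∈ , z , z∈ , c-d≡pz) =
    integral-+ a∈ c∈ , integral-+ b∈ d∈ , y + z , integral-+ y∈ z∈ ,
    trans (eq a b c d) (trans (cong₂ _+_ a-b≡py c-d≡pz) (sym (*-distribˡ-+ (fromℕ p) y z)))
    where
    eq : ∀ a b c d → a + c - (b + d) ≡ (a - b) + (c - d)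
    eq = solve-∀ ℚ-ring

  mod-* : ∀ {a b c d} → a ≡ b [mod p ] → c ≡ d [mod p ] → a * c ≡ b * d [mod p ]
  mod-* {a} {b} {c} {d} (a∈ , b∈ , y , y∈ , a-b≡py) (c∈ , d∈ , z , z∈ , c-d≡pz) =
    integral-* a∈ c∈ , integral-* b∈ d∈ , y * c + b * z , integral-+ (integral-* y∈ c∈) (integral-* b∈ z∈) ,
    trans (eq a b c d) (trans (cong₂ (λ u v → u * c + b * v) a-b≡py c-d≡pz) (collect (fromℕ p) y c b z))
    where
    eq : ∀ a b c d → a * c - b * d ≡ (a - b) * c + b * (c - d)
    eq = solve-∀ ℚ-ring
    collect : ∀ p y c b z → p * y * c + b * (p * z) ≡ p * (y * c + b * z)
    collect = solve-∀ ℚ-ring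

  mod-^ : ∀ {a b} k → a ≡ b [mod p ] → a ^ k ≡ b ^ k [mod p ]
  mod-^ zero    a≡b = mod-refl (integral-fromℤ 1ℤ)
  mod-^ (suc k) a≡b = mod-* a≡b (mod-^ k a≡b)

  mod-sum : ∀ {m} {f g : Fin m → ℚ} → (∀ i → f i ≡ g i [mod p ]) → sum f ≡ sum g [mod p ]
  mod-sum {zero}  f≡g = mod-refl (integral-fromℤ 0ℤ)
  mod-sum {suc m} f≡g = mod-+ (f≡g Fin.zero) (mod-sum (f≡g ∘ Fin.suc))

  mod-fromℤ : ∀ i j → + p ∣ℤ i ℤ.- j → fromℤ i ≡ fromℤ j [mod p ]
  mod-fromℤ i j (divides q i-j≡qp) = integral-fromℤ i , integral-fromℤ j , fromℤ q , integral-fromℤ q ,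
    trans (sym (fromℤ-minus i j)) (trans (cong fromℤ (trans i-j≡qp (ℤₚ.*-comm q (+ p)))) (fromℤ-* (+ p) q))

module Localization {p : ℕ} (p-prime : Prime p) where

  open ModuloPrime p-prime

  private instance
    _ = prime⇒nonZero p-prime
    _ = prime⇒nonTrivial p-prime

  ∤⇒coprime : ∀ {d} → ¬ + p ∣ℤ d → Coprime ℤ.∣ d ∣ p
  ∤⇒coprime p∤d (i∣d , i∣p) with prime⇒irreducible p-prime i∣p
  ... | inj₁ i≡1  = i≡1
  ... | inj₂ refl = contradiction (∣ᵤ⇒∣ i∣d) p∤d

  ∤↧ : ∀ {a} → Integral p a → ¬ + p ∣ℤ ↧ a
  ∤↧ (integral a⊥p) p∣↧a = ℕ.nonTrivial⇒≢1 (a⊥p (∣⇒∣ᵤ p∣↧a , ℕ∣.∣-refl))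

  -- Splits an element of ℤₚ into its integer numerator and the reciprocal of its denominator, so
  -- that congruences can be tested on the numerator.
  ↧⁻¹ : ∀ {a} → Integral p a → ∃ λ r → Integral p r × r * fromℤ (↧ a) ≡ 1ℚ × a ≡ fromℤ (↥ a) * r
  ↧⁻¹ {a@(mkℚ n d _)} a∈ = r , integral-÷ (↧ a) 1ℤ (∤⇒coprime (∤↧ a∈)) r*↧a≡1 , r*↧a≡1 , (begin
    a                          ≡⟨ *-identityʳ a ⟨
    a * 1ℚ                     ≡⟨ cong (a *_) r*↧a≡1 ⟨
    a * (r * fromℤ (↧ a))      ≡⟨ eq a r (fromℤ (↧ a)) ⟩
    a * fromℤ (↧ a) * r        ≡⟨ cong (_* r) (a*↧a≡↥a a) ⟩
    fromℤ (↥ a) * r            ∎)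
    where
    open ≡-Reasoning
    r = mkℚ 1ℤ d (1-coprimeTo (suc d))
    r*↧a≡1 = a*↧a≡↥a r
    eq : ∀ a r d → a * (r * d) ≡ a * d * r
    eq = solve-∀ ℚ-ring

  -- The numerator of `a` is a denominator for `1/ a`, and it is prime to p: if p divided it, `a`
  -- would be congruent to 0.
  integral-1/ : ∀ {a} .{{_ : NonZero a}} → Integral p a → ¬ a ≡ 0ℚ [mod p ] → Integral p (1/ a)
  integral-1/ {a} a∈ a≢0 = integral-÷ (↥ a) (↧ a) (∤⇒coprime p∤↥a) (begin
    1/ a * fromℤ (↥ a)          ≡⟨ cong (1/ a *_) (a*↧a≡↥a a) ⟨
    1/ a * (a * fromℤ (↧ a))    ≡⟨ *-assoc (1/ a) a (fromℤ (↧ a)) ⟨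
    1/ a * a * fromℤ (↧ a)      ≡⟨ cong (_* fromℤ (↧ a)) (*-inverseˡ a) ⟩
    1ℚ * fromℤ (↧ a)            ≡⟨ *-identityˡ _ ⟩
    fromℤ (↧ a)                 ∎)
    where
    open ≡-Reasoning
    p∤↥a : ¬ + p ∣ℤ ↥ a
    p∤↥a p∣↥a with r , r∈ , _ , a≡↥a*r ← ↧⁻¹ a∈ = a≢0
      (mod-trans (mod-reflexive a∈ a≡↥a*r)
        (mod-trans (mod-* (mod-fromℤ (↥ a) 0ℤ (subst (+ p ∣ℤ_) (sym (ℤₚ.+-identityʳ (↥ a))) p∣↥a)) (mod-refl r∈))
          (mod-reflexive (integral-* (integral-fromℤ 0ℤ) r∈) (*-zeroˡ r))))

  module _ (m : ℕ) (p≡2n+1 : p ≡ suc (suc m ℕ.+ suc m)) where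

    open Odd m p≡2n+1

    residue-exists : ∀ {a} → Integral p a → ∃ λ (r : Fin p) → a ≡ fromℕ (toℕ r) [mod p ]
    residue-exists {a} a∈ with r , r∈ , r*↧a≡1 , a≡↥a*r ← ↧⁻¹ a∈ =
      fromℕ< (n%ℕd<d i p) ,
      mod-trans (mod-reflexive a∈ a≡↥a*r) (mod-trans (mod-* (mod-refl (integral-fromℤ (↥ a))) r≡e)
        (mod-trans (mod-reflexive (integral-* (integral-fromℤ (↥ a)) (integral-fromℤ e)) (sym (fromℤ-* (↥ a) e)))
          (subst (λ k → fromℤ i ≡ fromℕ k [mod p ]) (sym (toℕ-fromℕ< (n%ℕd<d i p))) (mod-fromℤ i (+ (i ℤ.%ℕ p)) (a≡a%p i)))))
      where
      -- The exponent m + n is p - 2, so by Fermat's theorem `e` is an integer inverse of the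
      -- denominator modulo p.
      e = (↧ a) ^ℤ m ℤ.* (↧ a) ^ℤ n
      i = ↥ a ℤ.* e

      ↧a*e≡1 : fromℤ (↧ a) * fromℤ e ≡ 1ℚ [mod p ]
      ↧a*e≡1 = mod-trans
        (mod-reflexive (integral-* (integral-fromℤ (↧ a)) (integral-fromℤ e)) (trans (sym (fromℤ-* (↧ a) e))
          (cong fromℤ (sym (ℤₚ.*-assoc (↧ a) ((↧ a) ^ℤ m) ((↧ a) ^ℤ n))))))
        (mod-fromℤ ((↧ a) ^ℤ n ℤ.* (↧ a) ^ℤ n) 1ℤ (a^n*a^n≡1 (↧ a) (∤↧ a∈)))

      r≡e : r ≡ fromℤ e [mod p ]
      r≡e = mod-trans (mod-reflexive r∈ (sym (*-identityʳ r)))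
        (mod-trans (mod-* (mod-refl r∈) (mod-sym ↧a*e≡1))
          (mod-reflexive (integral-* r∈ (integral-* (integral-fromℤ (↧ a)) (integral-fromℤ e)))
            (trans (sym (*-assoc r (fromℤ (↧ a)) (fromℤ e))) (trans (cong (_* fromℤ e) r*↧a≡1) (*-identityˡ (fromℤ e))))))

    a≡residue : ∀ {a} → Integral p a → a ≡ fromℕ (residue p a) [mod p ]
    a≡residue {a} a∈ = residue-elim p a (λ r → a ≡ fromℕ r [mod p ]) (λ _ a≡r → a≡r) (residue-exists a∈)

    euler-ℚ : ∀ {a} → Integral p a → a ^ n ≡ fromℤ (legendre a p) [mod p ]
    euler-ℚ {a} a∈ = mod-trans (mod-^ n (a≡residue a∈))
      (mod-trans (mod-reflexive (integral-^ n (integral-fromℤ r)) (sym (fromℤ-^ r n)))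
        (mod-fromℤ (r ^ℤ n) (legendreℤ r p) (euler r)))
      where r = + residue p a

-- Legendre polynomials

private module ℚᶜ = CommutativeRing +-*-commutativeRing
open import Algebra.Definitions.RawSemiring +-*-rawSemiring using () renaming (_×_ to _×ℚ_)
open import Algebra.Properties.CommutativeSemiring.Exp ℚᶜ.commutativeSemiring using (^-distrib-*)
open import Algebra.Properties.Semiring.Exp ℚᶜ.semiring using (^-homo-*)
open import Algebra.Properties.Semiring.Sum ℚᶜ.semiring using (*-distribˡ-sum; sum-cong-≗)
open PowerSeries ℚᶜ.commutativeSemiring using (central; central-product; central-shift; central-square)

×ℚ≡* : ∀ m a → m ×ℚ a ≡ fromℕ m * a
×ℚ≡* zero    a = sym (*-zeroˡ a)
×ℚ≡* (suc m) a = begin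
  a + m ×ℚ a                ≡⟨ cong (λ z → a + z) (×ℚ≡* m a) ⟩
  a + fromℕ m * a           ≡⟨ cong (λ z → z + fromℕ m * a) (*-identityˡ a) ⟨
  1ℚ * a + fromℕ m * a      ≡⟨ *-distribʳ-+ a 1ℚ (fromℕ m) ⟨
  (1ℚ + fromℕ m) * a        ≡⟨ cong (_* a) (fromℤ-+ 1ℤ (+ m)) ⟨
  fromℕ (suc m) * a         ∎
  where open ≡-Reasoning

nCk*k![n-k]!≡n! : ∀ n k → k ℕ.≤ n → (n C k) ℕ.* (k ! ℕ.* (n ∸ k) !) ≡ n !
nCk*k![n-k]!≡n! n k k≤n =
  trans (cong (ℕ._* (k ! ℕ.* (n ∸ k) !)) (nCk≡n!/k![n-k]! k≤n)) (ℕ÷.m/n*n≡m (k![n∸k]!∣n! k≤n))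
  where instance _ = k ℕₚ.!* (n ∸ k) !≢0

-- With N = 2(n - k) and j = n - 2k one has N - j = n. Hence N! = C(N,j) j! n!, and n! splits again
-- through C(n,k). In particular the fraction in `legendreTerm` is an integer.
legendre-coefficient : ∀ n k → 2 ℕ.* k ℕ.≤ n →
  (2 ℕ.* n ∸ 2 ℕ.* k) ! ≡ (n C k) ℕ.* ((2 ℕ.* (n ∸ k)) C (n ∸ 2 ℕ.* k)) ℕ.* legendreDenominator n k
legendre-coefficient n k 2k≤n = begin
  (2 ℕ.* n ∸ 2 ℕ.* k) !                      ≡⟨ cong _! (ℕₚ.*-distribˡ-∸ 2 n k) ⟨
  N !                                        ≡⟨ nCk*k![n-k]!≡n! N j j≤N ⟨
  (N C j) ℕ.* (j ! ℕ.* (N ∸ j) !)            ≡⟨ cong (λ i → (N C j) ℕ.* (j ! ℕ.* i !)) N∸j≡n ⟩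
  (N C j) ℕ.* (j ! ℕ.* n !)                  ≡⟨ cong (λ i → (N C j) ℕ.* (j ! ℕ.* i)) (nCk*k![n-k]!≡n! n k k≤n) ⟨
  (N C j) ℕ.* (j ! ℕ.* ((n C k) ℕ.* (k ! ℕ.* (n ∸ k) !)))
    ≡⟨ eq (N C j) (j !) (n C k) (k !) ((n ∸ k) !) ⟩
  (n C k) ℕ.* (N C j) ℕ.* (k ! ℕ.* (n ∸ k) ! ℕ.* j !) ∎
  where
  open ≡-Reasoning
  N = 2 ℕ.* (n ∸ k)
  j = n ∸ 2 ℕ.* k

  k≤n : k ℕ.≤ n
  k≤n = ℕₚ.≤-trans (ℕₚ.m≤n*m k 2) 2k≤n

  j+n≡N : j ℕ.+ n ≡ N
  j+n≡N = begin
    n ∸ 2 ℕ.* k ℕ.+ n          ≡⟨ ℕₚ.+-∸-comm n 2k≤n ⟨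
    n ℕ.+ n ∸ 2 ℕ.* k          ≡⟨ cong (λ i → n ℕ.+ i ∸ 2 ℕ.* k) (ℕₚ.+-identityʳ n) ⟨
    2 ℕ.* n ∸ 2 ℕ.* k          ≡⟨ ℕₚ.*-distribˡ-∸ 2 n k ⟨
    N                          ∎

  j≤N : j ℕ.≤ N
  j≤N = subst (j ℕ.≤_) j+n≡N (ℕₚ.m≤m+n j n)

  N∸j≡n : N ∸ j ≡ n
  N∸j≡n = trans (cong (_∸ j) (sym j+n≡N)) (ℕₚ.m+n∸m≡n j n)

  eq : ∀ e j c k l → e ℕ.* (j ℕ.* (c ℕ.* (k ℕ.* l))) ≡ c ℕ.* e ℕ.* (k ℕ.* l ℕ.* j)
  eq = ℕ-Solver.solve-∀

legendreTerm≡ : ∀ n k x → 2 ℕ.* k ℕ.≤ n →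
  (n C k) ×ℚ ((- 1ℚ) ^ k * (((2 ℕ.* (n ∸ k)) C (n ∸ 2 ℕ.* k)) ×ℚ x ^ (n ∸ 2 ℕ.* k))) ≡ legendreTerm n x k
legendreTerm≡ n k x 2k≤n = begin
  A ×ℚ (s * (B ×ℚ y))                 ≡⟨ ×ℚ≡* A _ ⟩
  fromℕ A * (s * (B ×ℚ y))            ≡⟨ cong (λ z → fromℕ A * (s * z)) (×ℚ≡* B y) ⟩
  fromℕ A * (s * (fromℕ B * y))       ≡⟨ eq (fromℕ A) s (fromℕ B) y ⟩
  s * (fromℕ A * fromℕ B) * y         ≡⟨ cong (λ z → s * z * y) (fromℤ-* (+ A) (+ B)) ⟨
  s * fromℤ (+ A ℤ.* + B) * y         ≡⟨ cong (λ z → s * z * y) (/≡fromℤ _ (legendreDenominator n k) (+ A ℤ.* + B) quotient-eq) ⟨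
  s * (+ ((2 ℕ.* n ∸ 2 ℕ.* k) !) / legendreDenominator n k) * y ∎
  where
  open ≡-Reasoning
  instance _ = legendreDenominator≢0 n k
  A = n C k
  B = (2 ℕ.* (n ∸ k)) C (n ∸ 2 ℕ.* k)
  s = (- 1ℚ) ^ k
  y = x ^ (n ∸ 2 ℕ.* k)

  quotient-eq : + ((2 ℕ.* n ∸ 2 ℕ.* k) !) ≡ + A ℤ.* + B ℤ.* + legendreDenominator n k
  quotient-eq = begin
    + ((2 ℕ.* n ∸ 2 ℕ.* k) !)                  ≡⟨ cong +_ (legendre-coefficient n k 2k≤n) ⟩
    + (A ℕ.* B ℕ.* legendreDenominator n k)    ≡⟨ ℤₚ.pos-* (A ℕ.* B) (legendreDenominator n k) ⟩
    + (A ℕ.* B) ℤ.* + legendreDenominator n k  ≡⟨ cong (ℤ._* + legendreDenominator n k) (ℤₚ.pos-* A B) ⟩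
    + A ℤ.* + B ℤ.* + legendreDenominator n k  ∎

  eq : ∀ a s b y → a * (s * (b * y)) ≡ s * (a * b) * y
  eq = solve-∀ ℚ-ring

P≡central : ∀ n x → P n x ≡ ½ ^ n * central n (x - 1ℚ) (x + 1ℚ)
P≡central n x = cong (½ ^ n *_) (sym (trans
  -- Here e = -1 because (x - 1)(x + 1) = x² - 1. The ring identity has a variable in place of the
  -- unit, so its square is simplified separately.
  (central-square n (x - 1ℚ) (x + 1ℚ) x (- 1ℚ) (sum-eq x 1ℚ) (trans (product-eq x 1ℚ) (cong (λ z → x * x - z) (*-identityˡ 1ℚ))))
  (sum-cong-≗ {suc ⌊ n /2⌋} λ k →
    legendreTerm≡ n (toℕ k) x (subst (ℕ._≤ n) (ℕₚ.*-comm (toℕ k) 2) (k≤⌊n/2⌋⇒k*2≤n n (ℕₚ.≤-pred (toℕ<n k)))))))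
  where
  sum-eq : ∀ x e → (x - e) + (x + e) ≡ x + x
  sum-eq = solve-∀ ℚ-ring
  product-eq : ∀ x e → (x - e) * (x + e) ≡ x * x - e * e
  product-eq = solve-∀ ℚ-ring

-- Homogeneity and integrality of K(a, b)

central-term : ∀ n k a b →
  (n C k) ×ℚ a ^ k * ((n C (n ∸ k)) ×ℚ b ^ (n ∸ k)) ≡ fromℕ (n C k) * fromℕ (n C (n ∸ k)) * (a ^ k * b ^ (n ∸ k))
central-term n k a b = trans (cong₂ _*_ (×ℚ≡* (n C k) (a ^ k)) (×ℚ≡* (n C (n ∸ k)) (b ^ (n ∸ k))))
  (eq (fromℕ (n C k)) (a ^ k) (fromℕ (n C (n ∸ k))) (b ^ (n ∸ k)))
  where
  eq : ∀ c a d b → c * a * (d * b) ≡ c * d * (a * b)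
  eq = solve-∀ ℚ-ring

central≡sum : ∀ n a b →
  central n a b ≡ sum {suc n} (λ k → fromℕ (n C toℕ k) * fromℕ (n C (n ∸ toℕ k)) * (a ^ toℕ k * b ^ (n ∸ toℕ k)))
central≡sum n a b = trans (central-product n a b) (sum-cong-≗ {suc n} (λ k → central-term n (toℕ k) a b))

-- Every term has total degree k + (n - k) = n in a and b.
central-homogeneous : ∀ n c a b → c ^ n * central n a b ≡ central n (c * a) (c * b)
central-homogeneous n c a b = begin
  c ^ n * central n a b                ≡⟨ cong (c ^ n *_) (central≡sum n a b) ⟩
  c ^ n * sum {suc n} (λ k → coefficient (toℕ k) * (a ^ toℕ k * b ^ (n ∸ toℕ k)))
    ≡⟨ *-distribˡ-sum {suc n} (c ^ n) (λ k → coefficient (toℕ k) * (a ^ toℕ k * b ^ (n ∸ toℕ k))) ⟩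
  sum {suc n} (λ k → c ^ n * (coefficient (toℕ k) * (a ^ toℕ k * b ^ (n ∸ toℕ k))))
    ≡⟨ sum-cong-≗ {suc n} (λ k → term (toℕ k) (ℕₚ.≤-pred (toℕ<n k))) ⟩
  sum {suc n} (λ k → coefficient (toℕ k) * ((c * a) ^ toℕ k * (c * b) ^ (n ∸ toℕ k)))
    ≡⟨ central≡sum n (c * a) (c * b) ⟨
  central n (c * a) (c * b) ∎
  where
  open ≡-Reasoning
  coefficient : ℕ → ℚ
  coefficient k = fromℕ (n C k) * fromℕ (n C (n ∸ k))

  eq : ∀ u v t a b → u * v * (t * (a * b)) ≡ t * (u * a * (v * b))
  eq = solve-∀ ℚ-ring

  term : ∀ k → k ℕ.≤ n → c ^ n * (coefficient k * (a ^ k * b ^ (n ∸ k))) ≡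
                         coefficient k * ((c * a) ^ k * (c * b) ^ (n ∸ k))
  term k k≤n = begin
    c ^ n * (coefficient k * (a ^ k * b ^ (n ∸ k)))
      ≡⟨ cong (λ i → c ^ i * (coefficient k * (a ^ k * b ^ (n ∸ k)))) (ℕₚ.m+[n∸m]≡n k≤n) ⟨
    c ^ (k ℕ.+ (n ∸ k)) * (coefficient k * (a ^ k * b ^ (n ∸ k)))
      ≡⟨ cong (_* (coefficient k * (a ^ k * b ^ (n ∸ k)))) (^-homo-* c k (n ∸ k)) ⟩
    c ^ k * c ^ (n ∸ k) * (coefficient k * (a ^ k * b ^ (n ∸ k)))
      ≡⟨ eq (c ^ k) (c ^ (n ∸ k)) (coefficient k) (a ^ k) (b ^ (n ∸ k)) ⟩
    coefficient k * (c ^ k * a ^ k * (c ^ (n ∸ k) * b ^ (n ∸ k)))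
      ≡⟨ cong₂ (λ u v → coefficient k * (u * v)) (^-distrib-* c a k) (^-distrib-* c b (n ∸ k)) ⟨
    coefficient k * ((c * a) ^ k * (c * b) ^ (n ∸ k)) ∎

integral-central : ∀ {p a b} n → Integral p a → Integral p b → Integral p (central n a b)
integral-central {p} {a} {b} n a∈ b∈ = subst (Integral p) (sym (central≡sum n a b))
  (integral-sum λ (k : Fin (suc n)) → integral-* (integral-* (integral-fromℤ (+ (n C toℕ k))) (integral-fromℤ (+ (n C (n ∸ toℕ k)))))
    (integral-* (integral-^ (toℕ k) a∈) (integral-^ (n ∸ toℕ k) b∈)))

-1^k*a^k : ∀ k a → fromℤ (-1ℤ ^ℤ k) * a ^ k ≡ (- a) ^ k
-1^k*a^k k a = begin
  fromℤ (-1ℤ ^ℤ k) * a ^ k  ≡⟨ cong (_* a ^ k) (fromℤ-^ -1ℤ k) ⟩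
  (- 1ℚ) ^ k * a ^ k        ≡⟨ ^-distrib-* (- 1ℚ) a k ⟨
  (- 1ℚ * a) ^ k            ≡⟨ cong (_^ k) (trans (sym (neg-distribˡ-* 1ℚ a)) (cong -_ (*-identityˡ a))) ⟩
  (- a) ^ k                 ∎
  where open ≡-Reasoning

-- Reflection of K modulo p and the transformation of Pₙ

module _ {p : ℕ} (p-prime : Prime p) (m : ℕ) (p≡2n+1 : p ≡ suc (suc m ℕ.+ suc m)) where

  open ModuloPrime p-prime
  open Odd m p≡2n+1
  open Localization p-prime

  -- Termwise between `central-shift` and the product form: the sign from C(n+k,k) is absorbed into
  -- (-a)ᵏ, and by symmetry one of the two factors C(n,k) becomes C(n,n-k).
  central-reflect : ∀ {a d} → Integral p a → Integral p d → central n a (a + d) ≡ central n (- a) d [mod p ]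
  central-reflect {a} {d} a∈ d∈ = mod-trans
    (mod-reflexive (integral-central n a∈ (integral-+ a∈ d∈)) (central-shift n a (a + d) d refl))
    (mod-trans (mod-sum {m = suc n} λ k → term (toℕ k) (ℕₚ.≤-pred (toℕ<n k)))
      (mod-sym (mod-reflexive (integral-central n (integral-neg a∈) d∈) (central≡sum n (- a) d))))
    where
    open ≡-Reasoning
    term : ∀ k → k ℕ.≤ n →
      (n C k) ×ℚ (d ^ (n ∸ k) * (((n ℕ.+ k) C k) ×ℚ a ^ k)) ≡
      fromℕ (n C k) * fromℕ (n C (n ∸ k)) * ((- a) ^ k * d ^ (n ∸ k)) [mod p ]
    term k k≤n = subst (_≡ fromℕ A * fromℕ (n C (n ∸ k)) * ((- a) ^ k * y) [mod p ]) (sym left)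
      (mod-trans (mod-* (mod-fromℤ (+ B) (s ℤ.* + A) ([n+k]Ck≡[-1]^k*nCk k k≤n)) (mod-refl rest∈))
        (mod-reflexive (integral-* (integral-fromℤ (s ℤ.* + A)) rest∈) right))
      where
      A = n C k
      B = (n ℕ.+ k) C k
      s = -1ℤ ^ℤ k
      y = d ^ (n ∸ k)

      rest∈ : Integral p (fromℕ A * (a ^ k * y))
      rest∈ = integral-* (integral-fromℤ (+ A)) (integral-* (integral-^ k a∈) (integral-^ (n ∸ k) d∈))

      left : A ×ℚ (y * (B ×ℚ a ^ k)) ≡ fromℕ B * (fromℕ A * (a ^ k * y))
      left = begin
        A ×ℚ (y * (B ×ℚ a ^ k))               ≡⟨ ×ℚ≡* A _ ⟩
        fromℕ A * (y * (B ×ℚ a ^ k))          ≡⟨ cong (λ z → fromℕ A * (y * z)) (×ℚ≡* B (a ^ k)) ⟩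
        fromℕ A * (y * (fromℕ B * a ^ k))     ≡⟨ eq (fromℕ A) y (fromℕ B) (a ^ k) ⟩
        fromℕ B * (fromℕ A * (a ^ k * y))     ∎
        where
        eq : ∀ A y B x → A * (y * (B * x)) ≡ B * (A * (x * y))
        eq = solve-∀ ℚ-ring

      right : fromℤ (s ℤ.* + A) * (fromℕ A * (a ^ k * y)) ≡
              fromℕ A * fromℕ (n C (n ∸ k)) * ((- a) ^ k * y)
      right = begin
        fromℤ (s ℤ.* + A) * (fromℕ A * (a ^ k * y))   ≡⟨ cong (_* (fromℕ A * (a ^ k * y))) (fromℤ-* s (+ A)) ⟩
        fromℤ s * fromℕ A * (fromℕ A * (a ^ k * y))   ≡⟨ eq (fromℤ s) (fromℕ A) (a ^ k) y ⟩
        fromℕ A * fromℕ A * (fromℤ s * a ^ k * y)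
          ≡⟨ cong₂ (λ u v → fromℕ A * fromℕ u * (v * y)) (nCk≡nC[n∸k] k≤n) (-1^k*a^k k a) ⟩
        fromℕ A * fromℕ (n C (n ∸ k)) * ((- a) ^ k * y) ∎
        where
        eq : ∀ s A x y → s * A * (A * (x * y)) ≡ A * A * (s * x * y)
        eq = solve-∀ ℚ-ring

  p∤2 : ¬ + p ∣ℤ + 2
  p∤2 = 0<m<p⇒p∤m (ℕ.s≤s ℕ.z≤n) (subst (2 ℕ.<_) (sym p≡2n+1) (ℕ.s≤s (ℕₚ.+-mono-≤ {1} {suc m} {1} {suc m} (ℕ.s≤s ℕ.z≤n) (ℕ.s≤s ℕ.z≤n))))

  integral-½ : Integral p ½
  integral-½ = integral-÷ (+ 2) 1ℤ (∤⇒coprime p∤2) refl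

  -- Read off from K, which has integer coefficients; only the powers of ½ remain, and p is odd.
  integral-P : ∀ {x} → Integral p x → Integral p (P n x)
  integral-P {x} x∈ = subst (Integral p) (sym (P≡central n x))
    (integral-* (integral-^ n integral-½) (integral-central n (integral-+ x∈ (integral-neg (integral-fromℤ 1ℤ))) (integral-+ x∈ (integral-fromℤ 1ℤ))))

  2^n*2^n≡1 : fromℕ 2 ^ n * fromℕ 2 ^ n ≡ 1ℚ [mod p ]
  2^n*2^n≡1 = subst (_≡ 1ℚ [mod p ]) eq
      (mod-fromℤ ((+ 2) ^ℤ n ℤ.* (+ 2) ^ℤ n) 1ℤ (a^n*a^n≡1 (+ 2) p∤2))
    where
    eq : fromℤ ((+ 2) ^ℤ n ℤ.* (+ 2) ^ℤ n) ≡ fromℕ 2 ^ n * fromℕ 2 ^ n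
    eq = trans (fromℤ-* ((+ 2) ^ℤ n) ((+ 2) ^ℤ n)) (cong₂ _*_ (fromℤ-^ (+ 2) n) (fromℤ-^ (+ 2) n))

  -- Only the equation for `y` enters the computation, so no division has to be carried along.
  module _ {x y : ℚ} (x∈ : Integral p x) (y∈ : Integral p y) ([1+x]y≡3-x : (1ℚ + x) * y ≡ fromℕ 3 - x) where

    private
      c = 1ℚ + x
      c∈ : Integral p c
      c∈ = integral-+ (integral-fromℤ 1ℤ) x∈
      2∈ : Integral p (fromℕ 2)
      2∈ = integral-fromℤ (+ 2)

    [1+x]^n*P[y]≡2^n*P[x] : c ^ n * P n y ≡ fromℕ 2 ^ n * P n x [mod p ]
    [1+x]^n*P[y]≡2^n*P[x] = mod-trans
      (mod-* (mod-refl (integral-^ n c∈))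
        (mod-trans (mod-reflexive (integral-P y∈) P[y]≡)
          (mod-* (mod-refl (integral-^ n integral-½)) (central-reflect y-1∈ 2∈))))
      (mod-reflexive
        (integral-* (integral-^ n c∈) (integral-* (integral-^ n integral-½) (integral-central n (integral-neg y-1∈) 2∈)))
        scale)
      where
      open ≡-Reasoning
      y-1∈ : Integral p (y - 1ℚ)
      y-1∈ = integral-+ y∈ (integral-neg (integral-fromℤ 1ℤ))

      P[y]≡ : P n y ≡ ½ ^ n * central n (y - 1ℚ) (y - 1ℚ + fromℕ 2)
      -- Writing y + 1 as (y - 1) + 2 gives the shape a + d required for the reflection, with d = 2.
      P[y]≡ = trans (P≡central n y) (cong (λ z → ½ ^ n * central n (y - 1ℚ) z) (eq y 1ℚ))
        where
        eq : ∀ y e → y + e ≡ y - e + (e + e)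
        eq = solve-∀ ℚ-ring

      c*[1-y]≡2*[x-1] : c * - (y - 1ℚ) ≡ fromℕ 2 * (x - 1ℚ)
      c*[1-y]≡2*[x-1] = begin
        -- `fromℕ 2` and `fromℕ 3` compute to sums of `1ℚ`. The identities have a variable in place
        -- of `1ℚ`, and the inserted factors `1ℚ` make the last one homogeneous.
        c * - (y - 1ℚ)                     ≡⟨ expand c y 1ℚ ⟩
        c * 1ℚ - c * y                     ≡⟨ cong₂ _-_ (*-identityʳ c) [1+x]y≡3-x ⟩
        1ℚ + x - (fromℕ 3 - x)             ≡⟨ collect 1ℚ x ⟩
        (x + x) - (1ℚ + 1ℚ)                ≡⟨ cong₂ (λ u v → u + u - (v + v)) (*-identityˡ x) (*-identityˡ 1ℚ) ⟨
        1ℚ * x + 1ℚ * x - (1ℚ * 1ℚ + 1ℚ * 1ℚ) ≡⟨ factor 1ℚ x ⟩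
        fromℕ 2 * (x - 1ℚ)                 ∎
        where
        expand : ∀ c y e → c * - (y - e) ≡ c * e - c * y
        expand = solve-∀ ℚ-ring
        collect : ∀ e x → e + x - (e + e + e - x) ≡ (x + x) - (e + e)
        collect = solve-∀ ℚ-ring
        factor : ∀ e x → e * x + e * x - (e * e + e * e) ≡ (e + e) * (x - e)
        factor = solve-∀ ℚ-ring

      c*2≡2*[x+1] : c * fromℕ 2 ≡ fromℕ 2 * (x + 1ℚ)
      c*2≡2*[x+1] = trans (*-comm c (fromℕ 2)) (cong (fromℕ 2 *_) (+-comm 1ℚ x))

      swap : ∀ u v w → u * (v * w) ≡ v * (u * w)
      swap = solve-∀ ℚ-ring

      scale : c ^ n * (½ ^ n * central n (- (y - 1ℚ)) (fromℕ 2)) ≡ fromℕ 2 ^ n * P n x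
      scale = begin
        c ^ n * (½ ^ n * central n (- (y - 1ℚ)) (fromℕ 2))
          ≡⟨ swap (c ^ n) (½ ^ n) _ ⟩
        ½ ^ n * (c ^ n * central n (- (y - 1ℚ)) (fromℕ 2))
          ≡⟨ cong (½ ^ n *_) (central-homogeneous n c (- (y - 1ℚ)) (fromℕ 2)) ⟩
        ½ ^ n * central n (c * - (y - 1ℚ)) (c * fromℕ 2)
          ≡⟨ cong₂ (λ u v → ½ ^ n * central n u v) c*[1-y]≡2*[x-1] c*2≡2*[x+1] ⟩
        ½ ^ n * central n (fromℕ 2 * (x - 1ℚ)) (fromℕ 2 * (x + 1ℚ))
          ≡⟨ cong (½ ^ n *_) (central-homogeneous n (fromℕ 2) (x - 1ℚ) (x + 1ℚ)) ⟨
        ½ ^ n * (fromℕ 2 ^ n * central n (x - 1ℚ) (x + 1ℚ))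
          ≡⟨ swap (½ ^ n) (fromℕ 2 ^ n) _ ⟩
        fromℕ 2 ^ n * (½ ^ n * central n (x - 1ℚ) (x + 1ℚ))
          ≡⟨ cong (fromℕ 2 ^ n *_) (P≡central n x) ⟨
        fromℕ 2 ^ n * P n x ∎

    -- The factor 1 is replaced by 2ⁿ · 2ⁿ. One 2ⁿ is consumed in trading Pₙ(x) for (1 + x)ⁿ Pₙ(y);
    -- the other joins (1 + x)ⁿ to form the power in Euler's criterion.
    P[x]≡legendre*P[y] : P n x ≡ fromℤ (legendre (fromℕ 2 * (x + 1ℚ)) p) * P n y [mod p ]
    P[x]≡legendre*P[y] = mod-trans (mod-reflexive Px∈ (sym (*-identityˡ (P n x))))
      (mod-trans (mod-* (mod-sym 2^n*2^n≡1) (mod-refl Px∈))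
        (mod-trans (mod-reflexive (integral-* (integral-* 2^n∈ 2^n∈) Px∈) (*-assoc (fromℕ 2 ^ n) (fromℕ 2 ^ n) (P n x)))
          (mod-trans (mod-* (mod-refl 2^n∈) (mod-sym [1+x]^n*P[y]≡2^n*P[x]))
            (mod-trans (mod-reflexive (integral-* 2^n∈ (integral-* (integral-^ n c∈) Py∈)) rearrange)
              (mod-* (euler-ℚ m p≡2n+1 (integral-* 2∈ (integral-+ x∈ (integral-fromℤ 1ℤ)))) (mod-refl Py∈))))))
      where
      Px∈ = integral-P x∈
      Py∈ = integral-P y∈
      2^n∈ = integral-^ n 2∈
      rearrange : fromℕ 2 ^ n * (c ^ n * P n y) ≡ (fromℕ 2 * (x + 1ℚ)) ^ n * P n y
      rearrange = trans (sym (*-assoc (fromℕ 2 ^ n) (c ^ n) (P n y)))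
        (cong (_* P n y) (trans (sym (^-distrib-* (fromℕ 2) c n)) (cong (λ z → (fromℕ 2 * z) ^ n) (+-comm 1ℚ x))))

odd⇒suc-double : ∀ p → ¬ 2 ∣ p → p ≡ suc (⌊ p ∸ 1 /2⌋ ℕ.+ ⌊ p ∸ 1 /2⌋)
odd⇒suc-double zero          2∤p = contradiction (2 ℕ∣.∣0) 2∤p
odd⇒suc-double 1             2∤p = refl
odd⇒suc-double 2             2∤p = contradiction ℕ∣.∣-refl 2∤p
odd⇒suc-double (suc (suc (suc p))) 2∤p = cong (λ i → suc (suc i))
  (trans (odd⇒suc-double (suc p) (λ 2∣1+p → 2∤p (ℕ∣.∣m∣n⇒∣m+n ℕ∣.∣-refl 2∣1+p)))
    (sym (ℕₚ.+-suc ⌊ p /2⌋ ⌊ p /2⌋)))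

theorem2p6 : (p : ℕ) → Prime p → ¬ (2 ∣ p) →
    (x : ℚ) (x∈ℤₚ : Integral p x) (x≢-1 : ¬ (x ≡ - 1ℚ [mod p ])) →
    P ⌊ p ∸ 1 /2⌋ x
    ≡ fromℤ (legendre (fromℕ 2 * (x + 1ℚ)) p)
    * P ⌊ p ∸ 1 /2⌋ (_÷_ (fromℕ 3 - x) (1ℚ + x) {{1+x-nonZero p x∈ℤₚ x≢-1}})
    [mod p ]
theorem2p6 p p-prime 2∤p x x∈ℤₚ x≢-1 =
  transformation ⌊ p ∸ 1 /2⌋ (odd⇒suc-double p 2∤p)
  where
  instance _ = 1+x-nonZero p x∈ℤₚ x≢-1

  1+x≢0 : ¬ 1ℚ + x ≡ 0ℚ [mod p ]
  1+x≢0 (_ , 0∈ , z , z∈ , 1+x-0≡pz) = x≢-1 (x∈ℤₚ , integral-neg (integral-fromℤ 1ℤ) , z , z∈ , (begin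
    x - - 1ℚ       ≡⟨ eq x 1ℚ ⟩
    1ℚ + x         ≡⟨ +-identityʳ (1ℚ + x) ⟨
    1ℚ + x - 0ℚ    ≡⟨ 1+x-0≡pz ⟩
    fromℕ p * z    ∎))
    where
    open ≡-Reasoning
    eq : ∀ x e → x - - e ≡ e + x
    eq = solve-∀ ℚ-ring

  [1+x]y≡3-x : (1ℚ + x) * ((fromℕ 3 - x) ÷ (1ℚ + x)) ≡ fromℕ 3 - x
  [1+x]y≡3-x = begin
    (1ℚ + x) * ((fromℕ 3 - x) * 1/ (1ℚ + x))  ≡⟨ eq (1ℚ + x) (fromℕ 3 - x) (1/ (1ℚ + x)) ⟩
    (1ℚ + x) * 1/ (1ℚ + x) * (fromℕ 3 - x)    ≡⟨ cong (_* (fromℕ 3 - x)) (*-inverseʳ (1ℚ + x)) ⟩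
    1ℚ * (fromℕ 3 - x)                        ≡⟨ *-identityˡ _ ⟩
    fromℕ 3 - x                               ∎
    where
    open ≡-Reasoning
    eq : ∀ u v w → u * (v * w) ≡ u * w * v
    eq = solve-∀ ℚ-ring

  -- Generalising ⌊(p - 1)/2⌋ to a variable allows a case split on it; the value 0 would mean p = 1.
  transformation : ∀ n → p ≡ suc (n ℕ.+ n) →
    P n x ≡ fromℤ (legendre (fromℕ 2 * (x + 1ℚ)) p) * P n ((fromℕ 3 - x) ÷ (1ℚ + x)) [mod p ]
  transformation zero    p≡1    = contradiction (subst Prime p≡1 p-prime) ¬prime[1]
  transformation (suc m) p≡2n+1 = P[x]≡legendre*P[y] p-prime m p≡2n+1 x∈ℤₚ
    (integral-* (integral-+ (integral-fromℤ (+ 3)) (integral-neg x∈ℤₚ))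
      (Localization.integral-1/ p-prime (integral-+ (integral-fromℤ 1ℤ) x∈ℤₚ) 1+x≢0))
    [1+x]y≡3-x
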